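{- Let $\mathcal{A}$ be a finite list in a finitely generated abelian group $\Gamma$, and let $G_1,G_2$ be torsion-wise finite abelian groups. Then $$T^{G_1\times G_2}_{\mathcal{A}}(x,y)=\sum_{\mathcal{B}\subset\mathcal{A}}T^{G_1}_{\mathcal{B}}(0,y)\cdot T^{G_2}_{\mathcal{A}/\mathcal{B}}(x,0),$$ where $\mathcal{B}$ is regarded as a list in $\Gamma$ and $\mathcal{A}/\mathcal{B}$ as a list in $\Gamma/\langle\mathcal{B}\rangle$.
   Context: $G$ is torsion-wise finite if $G[d]=\{x\in G\mid dx=0\}$ is finite for all $d>0$. Sublists are distinguished by index. For a list $\mathcal{L}$ in a finitely generated abelian group $\Lambda$ and a sublist $\mathcal{S}$: $r_{\mathcal{S}}$ is the rank of $\langle\mathcal{S}\rangle$, $m(\mathcal{S};G)=\#\mathrm{Hom}((\Lambda/\langle\mathcal{S}\rangle)_{\mathrm{tor}},G)$, and $T^G_{\mathcal{L}}(x,y)=\sum_{\mathcal{S}\subset\mathcal{L}}m(\mathcal{S};G)(x-1)^{r_{\mathcal{L}}-r_{\mathcal{S}}}(y-1)^{\#\mathcal{S}-r_{\mathcal{S}}}$. The contraction $\mathcal{A}/\mathcal{B}$ is the list of cosets $\{\overline\alpha\mid\alpha\in\mathcal{A}\smallsetminus\mathcal{B}\}$ in $\Gamma/\langle\mathcal{B}\rangle$. -}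

module Defs where

open import Level using (Level; _⊔_)
open import Algebra.Bundles using (AbelianGroup; CommutativeRing; Semiring)
open import Algebra.Morphism.Bundles using (GroupHomomorphism)
import Algebra.Definitions.RawMonoid as RawMonoidOps
import Algebra.Definitions.RawSemiring as RawSemiringOps
import Algebra.Properties.AbelianGroup as AbelianGroupProperties
import Algebra.Properties.CommutativeMonoid.Mult as CommutativeMonoidMult
open import Axiom.ExcludedMiddle using (ExcludedMiddle)
open import Data.Fin.Base using (Fin)
open import Data.Fin.Subset using (Subset; inside; outside; ∣_∣)
open import Data.Integer.Base using (ℤ; +_; -[1+_]; 0ℤ)
open import Data.Nat.Base using (ℕ; zero; suc; _∸_; _≤_; _<_)
import Data.Nat.Base as ℕ
import Data.Nat.Properties as ℕ
open import Data.Product.Base using (Σ; ∃; _×_; _,_; proj₁)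
open import Data.Vec.Base using (Vec; []; _∷_)
open import Data.Vec.Membership.Propositional using (_∈_)
open import Data.Vec.Functional using (Vector)
open import Function.Bundles using (Inverse)
open import Function.Base using (_∘_)
open import Relation.Binary.Bundles using (Setoid)
import Relation.Binary.Construct.On as On
open import Relation.Binary.PropositionalEquality as ≡ using (_≡_)
import Relation.Binary.Reasoning.Setoid as SetoidReasoning
open import Relation.Nullary.Decidable.Core using (yes; no)
open import Relation.Unary using (Pred)

private
  variable
    a α g γ p r ρ : Level
    n : ℕ

-- The rank of a subgroup and the order of a Hom-group are not computable from
-- a finitely generated abelian group; they are total functions only classically.

Classical : Agda.Primitive.Setω
Classical = ∀ {ℓ} → ExcludedMiddle ℓ

-- Applied below only to predicates satisfied by at most one number.
-- The value 0 is a convention for predicates satisfied by none; it plays no role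
-- in T below, since finitely generated groups have a rank and their torsion
-- admits only finitely many homomorphisms to a torsion-wise finite group.

theNumber : Classical → Pred ℕ p → ℕ
theNumber em P with em {P = ∃ P}
... | yes (k , _) = k
... | no  _       = 0

HasCardinality : Setoid a α → ℕ → Set (a ⊔ α)
HasCardinality S k = Inverse S (≡.setoid (Fin k))

Finite : Setoid a α → Set (a ⊔ α)
Finite S = ∃ (HasCardinality S)

cardinality : Classical → Setoid a α → ℕ
cardinality em S = theNumber em (HasCardinality S)

module _ (Γ : AbelianGroup a α) where
  open AbelianGroup Γ
  open RawMonoidOps rawMonoid using (sum) renaming (_×_ to _×ⁿ_)
  open CommutativeMonoidMult commutativeMonoid
    using (×-congʳ; ×-assocˡ; ×-distrib-+; ×-homo-1)
  open AbelianGroupProperties Γ using (⁻¹-involutive; ⁻¹-∙-comm)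
  open SetoidReasoning setoid

  data ⟨_⟩ (L : Vec Carrier n) : Pred Carrier (a ⊔ α) where
    gen  : ∀ {x} → x ∈ L → ⟨ L ⟩ x
    ε∈   : ⟨ L ⟩ ε
    ∙∈   : ∀ {x y} → ⟨ L ⟩ x → ⟨ L ⟩ y → ⟨ L ⟩ (x ∙ y)
    ⁻¹∈  : ∀ {x} → ⟨ L ⟩ x → ⟨ L ⟩ (x ⁻¹)
    resp : ∀ {x y} → x ≈ y → ⟨ L ⟩ x → ⟨ L ⟩ y

  FinitelyGenerated : Set (a ⊔ α)
  FinitelyGenerated = ∃ λ k → Σ (Vec Carrier k) λ L → ∀ x → ⟨ L ⟩ x

  record IsSubgroup (P : Pred Carrier p) : Set (a ⊔ p) where
    field
      ε-closed  : P ε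
      ∙-closed  : ∀ {x y} → P x → P y → P (x ∙ y)
      ⁻¹-closed : ∀ {x} → P x → P (x ⁻¹)

  subgroup : {P : Pred Carrier p} → IsSubgroup P → AbelianGroup (a ⊔ p) α
  subgroup {P = P} H = record
    { Carrier        = Σ Carrier P
    ; _≈_            = λ u v → proj₁ u ≈ proj₁ v
    ; _∙_            = λ (x , Px) (y , Py) → x ∙ y , ∙-closed Px Py
    ; ε              = ε , ε-closed
    ; _⁻¹            = λ (x , Px) → x ⁻¹ , ⁻¹-closed Px
    ; isAbelianGroup = record
      { isGroup = record
        { isMonoid = record
          { isSemigroup = record
            { isMagma = record
              { isEquivalence = On.isEquivalence proj₁ isEquivalence
              ; ∙-cong        = ∙-cong
              }
            ; assoc = λ (x , _) (y , _) (z , _) → assoc x y z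
            }
          ; identity = (λ (x , _) → identityˡ x) , (λ (x , _) → identityʳ x)
          }
        ; inverse = (λ (x , _) → inverseˡ x) , (λ (x , _) → inverseʳ x)
        ; ⁻¹-cong = ⁻¹-cong
        }
      ; comm = λ (x , _) (y , _) → comm x y
      }
    }
    where open IsSubgroup H

  ⟨_⟩-group : Vec Carrier n → AbelianGroup (a ⊔ α) α
  ⟨ L ⟩-group = subgroup {P = ⟨ L ⟩} (record
    { ε-closed = ε∈ ; ∙-closed = ∙∈ ; ⁻¹-closed = ⁻¹∈ })

  -- Γ / ⟨ L ⟩: same carrier, with x ≈ y meaning x - y ∈ ⟨ L ⟩.
  -- An element of Γ therefore also denotes its own coset.

  _/⟨_⟩ : Vec Carrier n → AbelianGroup a (a ⊔ α)
  _/⟨_⟩ L = record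
    { Carrier        = Carrier
    ; _≈_            = λ x y → ⟨ L ⟩ (x - y)
    ; _∙_            = _∙_
    ; ε              = ε
    ; _⁻¹            = _⁻¹
    ; isAbelianGroup = record
      { isGroup = record
        { isMonoid = record
          { isSemigroup = record
            { isMagma = record
              { isEquivalence = record
                { refl  = lift refl
                ; sym   = λ {x} {y} d → resp (-‿swap x y) (⁻¹∈ d)
                ; trans = λ {x} {y} {z} d e → resp (-‿telescope x y z) (∙∈ d e)
                }
              ; ∙-cong = λ {x} {y} {u} {v} d e → resp (-‿∙ x y u v) (∙∈ d e)
              }
            ; assoc = λ x y z → lift (assoc x y z)
            }
          ; identity = (λ x → lift (identityˡ x)) , (λ x → lift (identityʳ x))
          }
        ; inverse = (λ x → lift (inverseˡ x)) , (λ x → lift (inverseʳ x))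
        ; ⁻¹-cong = λ {x} {y} d → resp (sym (⁻¹-∙-comm x (y ⁻¹))) (⁻¹∈ d)
        }
      ; comm = λ x y → lift (comm x y)
      }
    }
    where
    lift : ∀ {x y} → x ≈ y → ⟨ L ⟩ (x - y)
    lift {x} {y} e = resp (sym (trans (∙-congʳ e) (inverseʳ y))) ε∈

    -‿swap : ∀ x y → (x - y) ⁻¹ ≈ y - x
    -‿swap x y = begin
      (x - y) ⁻¹          ≈⟨ ⁻¹-∙-comm x (y ⁻¹) ⟨
      x ⁻¹ ∙ (y ⁻¹) ⁻¹    ≈⟨ ∙-congˡ (⁻¹-involutive y) ⟩
      x ⁻¹ ∙ y            ≈⟨ comm _ _ ⟩
      y - x               ∎

    -‿telescope : ∀ x y z → (x - y) ∙ (y - z) ≈ x - z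
    -‿telescope x y z = begin
      (x - y) ∙ (y - z)       ≈⟨ assoc _ _ _ ⟩
      x ∙ (y ⁻¹ ∙ (y - z))    ≈⟨ ∙-congˡ (assoc _ _ _) ⟨
      x ∙ ((y ⁻¹ ∙ y) - z)    ≈⟨ ∙-congˡ (∙-congʳ (inverseˡ y)) ⟩
      x ∙ (ε - z)             ≈⟨ ∙-congˡ (identityˡ _) ⟩
      x - z                   ∎

    -‿∙ : ∀ x y u v → (x - y) ∙ (u - v) ≈ (x ∙ u) - (y ∙ v)
    -‿∙ x y u v = begin
      (x - y) ∙ (u - v)         ≈⟨ assoc _ _ _ ⟩
      x ∙ (y ⁻¹ ∙ (u - v))      ≈⟨ ∙-congˡ (assoc _ _ _) ⟨
      x ∙ ((y ⁻¹ ∙ u) - v)      ≈⟨ ∙-congˡ (∙-congʳ (comm _ _)) ⟩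
      x ∙ ((u ∙ y ⁻¹) - v)      ≈⟨ ∙-congˡ (assoc _ _ _) ⟩
      x ∙ (u ∙ (y ⁻¹ ∙ v ⁻¹))   ≈⟨ assoc _ _ _ ⟨
      (x ∙ u) ∙ (y ⁻¹ ∙ v ⁻¹)   ≈⟨ ∙-congˡ (⁻¹-∙-comm y v) ⟩
      (x ∙ u) - (y ∙ v)         ∎

  _[_] : ℕ → Setoid (a ⊔ α) α
  _[_] d = On.setoid {B = Σ Carrier λ x → d ×ⁿ x ≈ ε} setoid proj₁

  TorsionWiseFinite : Set (a ⊔ α)
  TorsionWiseFinite = ∀ d → 0 < d → Finite (_[_] d)

  torsion : AbelianGroup (a ⊔ α) α
  torsion = subgroup {P = λ x → ∃ λ d → 0 < d × d ×ⁿ x ≈ ε} (record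
    { ε-closed  = 1 , ℕ.≤-refl , ×-homo-1 ε
    ; ∙-closed  = λ {x} {y} (d , 0<d , dx) (e , 0<e , ey) →
        d ℕ.* e , ℕ.*-mono-≤ 0<d 0<e , (begin
          (d ℕ.* e) ×ⁿ (x ∙ y)                    ≈⟨ ×-distrib-+ x y (d ℕ.* e) ⟩
          (d ℕ.* e) ×ⁿ x ∙ (d ℕ.* e) ×ⁿ y         ≈⟨ ∙-cong (multiple d e x dx) (×ⁿ-of-≈ε d e y ey) ⟩
          ε ∙ ε                                   ≈⟨ identityˡ ε ⟩
          ε                                       ∎)
    ; ⁻¹-closed = λ {x} (d , 0<d , dx) → d , 0<d , (begin
        d ×ⁿ (x ⁻¹)                 ≈⟨ identityʳ _ ⟨
        d ×ⁿ (x ⁻¹) ∙ ε             ≈⟨ ∙-congˡ dx ⟨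
        d ×ⁿ (x ⁻¹) ∙ d ×ⁿ x        ≈⟨ ×-distrib-+ (x ⁻¹) x d ⟨
        d ×ⁿ (x ⁻¹ ∙ x)           ≈⟨ ×-congʳ d (inverseˡ x) ⟩
        d ×ⁿ ε                    ≈⟨ ×ⁿ-ε d ⟩
        ε                         ∎)
    })
    where
    ×ⁿ-ε : ∀ k → k ×ⁿ ε ≈ ε
    ×ⁿ-ε zero    = refl
    ×ⁿ-ε (suc k) = trans (identityˡ _) (×ⁿ-ε k)

    ×ⁿ-of-≈ε : ∀ d e y → e ×ⁿ y ≈ ε → (d ℕ.* e) ×ⁿ y ≈ ε
    ×ⁿ-of-≈ε d e y ey = trans (sym (×-assocˡ y d e)) (trans (×-congʳ d ey) (×ⁿ-ε d))

    multiple : ∀ d e x → d ×ⁿ x ≈ ε → (d ℕ.* e) ×ⁿ x ≈ ε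
    multiple d e x dx rewrite ℕ.*-comm d e = ×ⁿ-of-≈ε e d x dx

  infixr 8 _·_

  _·_ : ℤ → Carrier → Carrier
  (+ k)    · x = k ×ⁿ x
  -[1+ k ] · x = (suc k ×ⁿ x) ⁻¹

  Independent : Vector Carrier n → Set α
  Independent {n = n} v = ∀ (c : Vector ℤ n) → sum (λ i → c i · v i) ≈ ε → ∀ i → c i ≡ 0ℤ

  HasRank : ℕ → Set (a ⊔ α)
  HasRank k = ∃ (Independent {k})
            × (∀ {s} (v : Vector Carrier s) → Independent v → s ≤ k)

rank : Classical → AbelianGroup a α → ℕ
rank em Γ = theNumber em (HasRank Γ)

Hom : AbelianGroup a α → AbelianGroup g γ → Setoid (a ⊔ α ⊔ g ⊔ γ) (a ⊔ γ)
Hom Γ G = record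
  { Carrier       = GroupHomomorphism Γ.rawGroup G.rawGroup
  ; _≈_           = λ φ ψ → ∀ x → ⟦ φ ⟧ x G.≈ ⟦ ψ ⟧ x
  ; isEquivalence = record
    { refl  = λ _ → G.refl
    ; sym   = λ e x → G.sym (e x)
    ; trans = λ d e x → G.trans (d x) (e x)
    }
  }
  where
  module Γ = AbelianGroup Γ
  module G = AbelianGroup G
  open GroupHomomorphism using (⟦_⟧)

-- Sublists are distinguished by index, so they are given by sets of positions.

sublist : {X : Set a} (S : Subset n) → Vec X n → Vec X ∣ S ∣
sublist []            []       = []
sublist (inside  ∷ S) (x ∷ xs) = x ∷ sublist S xs
sublist (outside ∷ S) (x ∷ xs) = sublist S xs

module _ (R : CommutativeRing r ρ) where
  open CommutativeRing R using (Carrier; _+_)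

  ∑⊆ : ∀ n → (Subset n → Carrier) → Carrier
  ∑⊆ zero    f = f []
  ∑⊆ (suc n) f = ∑⊆ n (f ∘ (outside ∷_)) + ∑⊆ n (f ∘ (inside ∷_))

module _ (em : Classical) (Λ : AbelianGroup a α) where
  open AbelianGroup Λ using (Carrier)

  r⟨_⟩ : Vec Carrier n → ℕ
  r⟨ L ⟩ = rank em (⟨_⟩-group Λ L)

  multiplicity : Vec Carrier n → AbelianGroup g γ → ℕ
  multiplicity L G = cardinality em (Hom (torsion (_/⟨_⟩ Λ L)) G)

  -- The polynomial with integer coefficients T^G_L, given by its values at
  -- pairs of elements of an arbitrary commutative ring R.  Its value in
  -- R = ℤ[x,y] at the two indeterminates is the polynomial itself.

  T : Vec Carrier n → AbelianGroup g γ → (R : CommutativeRing r ρ) →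
      let module R = CommutativeRing R in R.Carrier → R.Carrier → R.Carrier
  T {n = n} L G R x y = ∑⊆ R n λ S →
    let L[S] = sublist S L in
    multiplicity L[S] G ×ⁿ
      ((x - 1#) ^ (r⟨ L ⟩ ∸ r⟨ L[S] ⟩) * (y - 1#) ^ (∣ S ∣ ∸ r⟨ L[S] ⟩))
    where
    open CommutativeRing R using (_-_; _*_; 1#; semiring)
    open RawSemiringOps (Semiring.rawSemiring semiring) using (_^_) renaming (_×_ to _×ⁿ_)

{-# OPTIONS --safe #-}

-- Write S ⊆ B for the subset indexing a summand of T_B(0,y), and V = B ∪ U for
-- the one indexing a summand of T_{A/B}(x,0).  Since r_{A/B} = r_A - r_B,
-- r_U = r_V - r_B in Γ/⟨B⟩ and (Γ/⟨B⟩)/⟨U⟩ = Γ/⟨V⟩, the product of the two summands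
-- depends on B only through the sign (-1)^|V ∖ B|.  Summed over S ⊆ B ⊆ V these
-- signs cancel unless S = V, and the terms with S = V add up to the left-hand
-- side, as #Hom(-,G₁ × G₂) = #Hom(-,G₁) · #Hom(-,G₂).
--
-- Additivity of the rank comes from adding generators one at a time: a generator
-- raises the rank by 1 unless a nonzero multiple of it already lies in the span,
-- and that condition for ⟨B ++ U⟩ in Γ is the one for ⟨U⟩ in Γ/⟨B⟩.

module Submission where

open import Defs
open import Level using (Level; _⊔_)
open import Algebra.Bundles using (AbelianGroup; CommutativeMonoid; CommutativeRing; Semiring)
open import Algebra.Construct.DirectProduct using (abelianGroup)
import Algebra.Definitions.RawMonoid as RawMonoidOps
import Algebra.Definitions.RawSemiring as RawSemiringOps
open import Algebra.Morphism.Bundles using (GroupHomomorphism)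
open import Algebra.Morphism.Construct.Composition using (groupHomomorphism)
import Algebra.Properties.AbelianGroup as AbelianGroupProperties
import Algebra.Properties.CommutativeMonoid.Mult as CommutativeMonoidMult
import Algebra.Properties.CommutativeMonoid.Sum as CommutativeMonoidSum
import Algebra.Properties.CommutativeSemigroup as CommutativeSemigroupProperties
import Algebra.Properties.Semiring.Exp as SemiringExp
import Algebra.Properties.Semiring.Mult as SemiringMult
import Algebra.Solver.Ring.NaturalCoefficients.Default as CommutativeSemiringSolver
open import Data.Fin.Base using (Fin; zero; suc; punchIn)
open import Data.Fin.Permutation using (↔⇒≡)
open import Data.Fin.Properties using (any?; *↔×)
open import Data.Fin.Subset using (Subset; inside; outside; ∁; ∣_∣)
open import Data.Integer.Base as ℤ using (ℤ; +_; -[1+_]; 0ℤ; 1ℤ; _⊖_)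
import Data.Integer.Properties as ℤ
open import Data.Nat.Base as ℕ using (ℕ; zero; suc; _≤_; _<_; z≤n; s≤s)
import Data.Nat.Properties as ℕ
open import Data.Product.Base using (Σ; ∃; _×_; _,_; proj₁; proj₂)
open import Data.Product.Function.NonDependent.Setoid using (_×-inverse_)
open import Data.Product.Relation.Binary.Pointwise.NonDependent using (×-setoid; Pointwise-≡↔≡)
open import Data.Sum.Base as Sum using (_⊎_; inj₁; inj₂; [_,_])
open import Data.Vec.Base using (Vec; []; _∷_; _++_)
open import Data.Vec.Functional using (Vector; insertAt)
open import Data.Vec.Functional.Properties using (insertAt-lookup; insertAt-punchIn)
open import Data.Vec.Membership.Propositional using (_∈_)
open import Data.Vec.Membership.Propositional.Properties using (∈-++⁺ˡ; ∈-++⁺ʳ)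
open import Data.Vec.Relation.Unary.Any using (here; there)
open import Data.Vec.Relation.Unary.Any.Properties using () renaming (++⁻ to ∈-++⁻)
open import Function.Base using (_∘_)
open import Function.Bundles using (Inverse)
import Function.Construct.Composition as Composition
import Function.Construct.Identity as Identity
import Function.Construct.Symmetry as Symmetry
open import Relation.Binary.Bundles using (Setoid)
open import Relation.Binary.PropositionalEquality as ≡ using (_≡_)
import Relation.Binary.Reasoning.Setoid as SetoidReasoning
open import Relation.Nullary.Decidable.Core using (yes; no; ¬?)
open import Relation.Nullary.Negation using (¬_; contradiction)
open import Relation.Unary using (Pred; _⊆_)

private
  variable
    a α b β c γ g g′ ℓ p q r ρ : Level
    k m n s : ℕ

-- Integer multiples and spans

module IntegerMultiples (Γ : AbelianGroup a α) where
  open AbelianGroup Γ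
  open RawMonoidOps rawMonoid using (sum) renaming (_×_ to _×ⁿ_)
  open CommutativeMonoidMult commutativeMonoid
    using (×-congʳ; ×-homo-+; ×-distrib-+; ×-homo-1)
  open AbelianGroupProperties Γ using (⁻¹-∙-comm; ε⁻¹≈ε; inverseˡ-unique)
  open CommutativeSemigroupProperties commutativeSemigroup using (interchange)
  open SetoidReasoning setoid

  infixr 8 _∙ᶻ_
  _∙ᶻ_ : ℤ → Carrier → Carrier
  _∙ᶻ_ = _·_ Γ

  ·-congˡ : ∀ c {x y} → x ≈ y → c ∙ᶻ x ≈ c ∙ᶻ y
  ·-congˡ (+ k)    x≈y = ×-congʳ k x≈y
  ·-congˡ -[1+ k ] x≈y = ⁻¹-cong (×-congʳ (suc k) x≈y)

  ·-congʳ : ∀ {c d} x → c ≡ d → c ∙ᶻ x ≈ d ∙ᶻ x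
  ·-congʳ x ≡.refl = refl

  ·-distribˡ-∙ : ∀ c x y → c ∙ᶻ (x ∙ y) ≈ c ∙ᶻ x ∙ c ∙ᶻ y
  ·-distribˡ-∙ (+ k)    x y = ×-distrib-+ x y k
  ·-distribˡ-∙ -[1+ k ] x y =
    trans (⁻¹-cong (×-distrib-+ x y (suc k))) (sym (⁻¹-∙-comm _ _))

  -- Sums of integers of opposite sign reduce to `_⊖_`, so this settles the mixed cases of
  -- `·-distribʳ-+`. The recursion cancels one copy of `x` against its inverse.
  ⊖-· : ∀ m n x → (m ⊖ n) ∙ᶻ x ≈ m ×ⁿ x - n ×ⁿ x
  ⊖-· m zero x = begin
    m ×ⁿ x            ≈⟨ identityʳ _ ⟨
    m ×ⁿ x ∙ ε        ≈⟨ ∙-congˡ ε⁻¹≈ε ⟨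
    m ×ⁿ x - ε        ∎
  ⊖-· zero (suc n) x = begin
    (suc n ×ⁿ x) ⁻¹    ≈⟨ identityˡ _ ⟨
    ε - suc n ×ⁿ x     ∎
  ⊖-· (suc m) (suc n) x = begin
    (suc m ⊖ suc n) ∙ᶻ x                    ≈⟨ ·-congʳ x (ℤ.[1+m]⊖[1+n]≡m⊖n m n) ⟩
    (m ⊖ n) ∙ᶻ x                            ≈⟨ ⊖-· m n x ⟩
    m ×ⁿ x - n ×ⁿ x                         ≈⟨ identityˡ _ ⟨
    ε ∙ (m ×ⁿ x - n ×ⁿ x)                   ≈⟨ ∙-congʳ (inverseʳ x) ⟨
    (x ∙ x ⁻¹) ∙ (m ×ⁿ x ∙ (n ×ⁿ x) ⁻¹)     ≈⟨ interchange _ _ _ _ ⟩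
    (x ∙ m ×ⁿ x) ∙ (x ⁻¹ ∙ (n ×ⁿ x) ⁻¹)     ≈⟨ ∙-congˡ (⁻¹-∙-comm _ _) ⟩
    suc m ×ⁿ x - suc n ×ⁿ x                 ∎

  ·-distribʳ-+ : ∀ c d x → (c ℤ.+ d) ∙ᶻ x ≈ c ∙ᶻ x ∙ d ∙ᶻ x
  ·-distribʳ-+ (+ m)    (+ n)    x = ×-homo-+ x m n
  ·-distribʳ-+ (+ m)    -[1+ n ] x = ⊖-· m (suc n) x
  ·-distribʳ-+ -[1+ m ] (+ n)    x = trans (⊖-· n (suc m) x) (comm _ _)
  ·-distribʳ-+ -[1+ m ] -[1+ n ] x = begin
    (suc (suc (m ℕ.+ n)) ×ⁿ x) ⁻¹          ≡⟨ ≡.cong (λ k → (suc k ×ⁿ x) ⁻¹) (ℕ.+-suc m n) ⟨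
    ((suc m ℕ.+ suc n) ×ⁿ x) ⁻¹            ≈⟨ ⁻¹-cong (×-homo-+ x (suc m) (suc n)) ⟩
    (suc m ×ⁿ x ∙ suc n ×ⁿ x) ⁻¹           ≈⟨ ⁻¹-∙-comm _ _ ⟨
    (suc m ×ⁿ x) ⁻¹ ∙ (suc n ×ⁿ x) ⁻¹      ∎

  ·-negˡ : ∀ c x → (ℤ.- c) ∙ᶻ x ≈ (c ∙ᶻ x) ⁻¹
  ·-negˡ c x = inverseˡ-unique _ _ (begin
    (ℤ.- c) ∙ᶻ x ∙ c ∙ᶻ x   ≈⟨ ·-distribʳ-+ (ℤ.- c) c x ⟨
    (ℤ.- c ℤ.+ c) ∙ᶻ x      ≈⟨ ·-congʳ x (ℤ.+-inverseˡ c) ⟩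
    ε                       ∎)

  ·-zeroʳ : ∀ c → c ∙ᶻ ε ≈ ε
  ·-zeroʳ c = begin
    c ∙ᶻ ε                                 ≈⟨ identityʳ _ ⟨
    c ∙ᶻ ε ∙ ε                             ≈⟨ ∙-congˡ (inverseʳ (c ∙ᶻ ε)) ⟨
    c ∙ᶻ ε ∙ (c ∙ᶻ ε - c ∙ᶻ ε)             ≈⟨ assoc _ _ _ ⟨
    (c ∙ᶻ ε ∙ c ∙ᶻ ε) - c ∙ᶻ ε             ≈⟨ ∙-congʳ (·-distribˡ-∙ c ε ε) ⟨
    c ∙ᶻ (ε ∙ ε) - c ∙ᶻ ε                  ≈⟨ ∙-congʳ (·-congˡ c (identityˡ ε)) ⟩
    c ∙ᶻ ε - c ∙ᶻ ε                        ≈⟨ inverseʳ _ ⟩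
    ε                                      ∎

  ·-negʳ : ∀ c x → c ∙ᶻ (x ⁻¹) ≈ (c ∙ᶻ x) ⁻¹
  ·-negʳ c x = inverseˡ-unique _ _ (begin
    c ∙ᶻ (x ⁻¹) ∙ c ∙ᶻ x    ≈⟨ ·-distribˡ-∙ c (x ⁻¹) x ⟨
    c ∙ᶻ (x ⁻¹ ∙ x)         ≈⟨ ·-congˡ c (inverseˡ x) ⟩
    c ∙ᶻ ε                  ≈⟨ ·-zeroʳ c ⟩
    ε                       ∎)

  ·-identityˡ : ∀ x → 1ℤ ∙ᶻ x ≈ x
  ·-identityˡ = ×-homo-1

  private
    ·-assoc-+ : ∀ k d x → (+ k ℤ.* d) ∙ᶻ x ≈ k ×ⁿ (d ∙ᶻ x)
    ·-assoc-+ zero    d x = ·-congʳ x (ℤ.*-zeroˡ d)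
    ·-assoc-+ (suc k) d x = begin
      (+ suc k ℤ.* d) ∙ᶻ x         ≈⟨ ·-congʳ x (ℤ.suc-* (+ k) d) ⟩
      (d ℤ.+ + k ℤ.* d) ∙ᶻ x       ≈⟨ ·-distribʳ-+ d (+ k ℤ.* d) x ⟩
      d ∙ᶻ x ∙ (+ k ℤ.* d) ∙ᶻ x    ≈⟨ ∙-congˡ (·-assoc-+ k d x) ⟩
      d ∙ᶻ x ∙ k ×ⁿ (d ∙ᶻ x)       ∎

  ·-assoc : ∀ c d x → (c ℤ.* d) ∙ᶻ x ≈ c ∙ᶻ (d ∙ᶻ x)
  ·-assoc (+ k)    d x = ·-assoc-+ k d x
  ·-assoc -[1+ k ] d x = begin
    (-[1+ k ] ℤ.* d) ∙ᶻ x           ≈⟨ ·-congʳ x (ℤ.neg-distribˡ-* (+ suc k) d) ⟨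
    (ℤ.- (+ suc k ℤ.* d)) ∙ᶻ x      ≈⟨ ·-negˡ (+ suc k ℤ.* d) x ⟩
    ((+ suc k ℤ.* d) ∙ᶻ x) ⁻¹       ≈⟨ ⁻¹-cong (·-assoc-+ (suc k) d x) ⟩
    (suc k ×ⁿ (d ∙ᶻ x)) ⁻¹          ∎

  -- Collects the contributions of the pivot vector in `w′-ind` into one coefficient, whose value is
  -- irrelevant there.
  sum-multiples : (c : Vector ℤ k) → ∀ x → ∃ λ e → sum (λ i → c i ∙ᶻ x) ≈ e ∙ᶻ x
  sum-multiples {zero}  c x = 0ℤ , refl
  sum-multiples {suc k} c x with sum-multiples (c ∘ suc) x
  ... | e , eq = c zero ℤ.+ e , trans (∙-congˡ eq) (sym (·-distribʳ-+ (c zero) e x))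

  module _ {P : Pred Carrier p} (H : IsSubgroup Γ P) where
    open IsSubgroup H

    ×-closed : ∀ k {x} → P x → P (k ×ⁿ x)
    ×-closed zero    Px = ε-closed
    ×-closed (suc k) Px = ∙-closed Px (×-closed k Px)

    ·-closed : ∀ c {x} → P x → P (c ∙ᶻ x)
    ·-closed (+ k)    Px = ×-closed k Px
    ·-closed -[1+ k ] Px = ⁻¹-closed (×-closed (suc k) Px)

    sum-closed : (v : Vector Carrier k) → (∀ i → P (v i)) → P (sum v)
    sum-closed {zero}  v Pv = ε-closed
    sum-closed {suc k} v Pv = ∙-closed (Pv zero) (sum-closed (v ∘ suc) (Pv ∘ suc))

  spanIsSubgroup : (L : Vec Carrier n) → IsSubgroup Γ (⟨_⟩ Γ L)
  spanIsSubgroup L = record { ε-closed = ε∈ ; ∙-closed = ∙∈ ; ⁻¹-closed = ⁻¹∈ }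

  -- Induction on membership in a span, packaged so that each use checks only generators, closure
  -- and compatibility with `≈`. The last is a separate argument because `IsSubgroup` does not
  -- include it.
  span-least : {P : Pred Carrier p} → IsSubgroup Γ P → (∀ {x y} → x ≈ y → P x → P y) →
               {L : Vec Carrier n} → (∀ {x} → x ∈ L → P x) → ∀ {x} → ⟨_⟩ Γ L x → P x
  span-least {P = P} H P-resp {L} L⊆P = go
    where
    open IsSubgroup H
    go : ∀ {x} → ⟨_⟩ Γ L x → P x
    go (gen x∈L)  = L⊆P x∈L
    go ε∈         = ε-closed
    go (∙∈ d e)   = ∙-closed (go d) (go e)
    go (⁻¹∈ d)    = ⁻¹-closed (go d)
    go (resp e d) = P-resp e (go d)

  span-mono : {L : Vec Carrier m} {M : Vec Carrier n} →
              (∀ {x} → x ∈ L → x ∈ M) → ∀ {x} → ⟨_⟩ Γ L x → ⟨_⟩ Γ M x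
  span-mono {M = M} L⊆M = span-least (spanIsSubgroup M) resp (gen ∘ L⊆M)

  lift : (L : Vec Carrier n) → ∀ {x y} → x ≈ y → ⟨_⟩ Γ L (x - y)
  lift L {y = y} x≈y = resp (sym (trans (∙-congʳ x≈y) (inverseʳ y))) ε∈

  -- Triviality of `x` in the quotient unfolds to membership of `x - ε`, which is not definitionally
  -- membership of `x`; this and `raise` pass between the two.
  lower : (L : Vec Carrier n) → ∀ {x} → ⟨_⟩ Γ L (x - ε) → ⟨_⟩ Γ L x
  lower L = resp (trans (∙-congˡ ε⁻¹≈ε) (identityʳ _))

  raise : (L : Vec Carrier n) → ∀ {x} → ⟨_⟩ Γ L x → ⟨_⟩ Γ L (x - ε)
  raise L = resp (sym (trans (∙-congˡ ε⁻¹≈ε) (identityʳ _)))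

-- Ranks

module _ (Γ : AbelianGroup a α) where
  open AbelianGroup Γ
  open RawMonoidOps rawMonoid using (sum) renaming (_×_ to _×ⁿ_)
  open CommutativeMonoidSum commutativeMonoid
    using (∑-distrib-+; sum-cong-≋; sum-remove; sum-replicate-zero)
  open AbelianGroupProperties Γ using (⁻¹-involutive; inverseˡ-unique; ε⁻¹≈ε)
  open CommutativeSemigroupProperties commutativeSemigroup using (interchange)
  open IntegerMultiples Γ
  open SetoidReasoning setoid

  -- Keeps the vectors in the ambient group, so that families in different spans can be compared
  -- directly; `RankOf⇒HasRank` passes to the subgroup as a group of its own.
  record IndependentIn (P : Pred Carrier p) (k : ℕ) : Set (a ⊔ α ⊔ p) where
    constructor independentIn
    field
      vectors     : Vector Carrier k
      members     : ∀ i → P (vectors i)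
      independent : Independent Γ vectors

  record RankOf (P : Pred Carrier p) (k : ℕ) : Set (a ⊔ α ⊔ p) where
    constructor rankOf
    field
      witness : IndependentIn P k
      maximal : ∀ {s} → IndependentIn P s → s ≤ k

  IndependentIn-mono : {P : Pred Carrier p} {Q : Pred Carrier q} →
                       P ⊆ Q → IndependentIn P k → IndependentIn Q k
  IndependentIn-mono P⊆Q (independentIn v Pv ind) = independentIn v (λ i → P⊆Q (Pv i)) ind

  RankOf-mono : {P : Pred Carrier p} {Q : Pred Carrier q} →
                P ⊆ Q → RankOf P k → RankOf Q m → k ≤ m
  RankOf-mono P⊆Q (rankOf inP _) (rankOf _ max) = max (IndependentIn-mono P⊆Q inP)

  -- Equality in the subgroup is equality of first components, so a linear relation there and its
  -- projection have the same coefficients. The two sums agree only by induction on their length,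
  -- which is `sum-proj₁`.
  RankOf⇒HasRank : {P : Pred Carrier p} (H : IsSubgroup Γ P) →
                   RankOf P k → HasRank (subgroup Γ H) k
  RankOf⇒HasRank {P = P} H (rankOf (independentIn v Pv ind) max) =
    ((λ i → v i , Pv i) , λ c eq → ind c (trans (reflexive (≡.sym (sum-proj₁ c λ i → v i , Pv i))) eq)) ,
    λ w ind-w → max (independentIn (proj₁ ∘ w) (proj₂ ∘ w) λ c eq →
      ind-w c (trans (reflexive (sum-proj₁ c w)) eq))
    where
    module H = AbelianGroup (subgroup Γ H)
    open RawMonoidOps H.rawMonoid using () renaming (sum to sumᴴ; _×_ to _×ᴴ_)

    ×-proj₁ : ∀ k u → proj₁ (k ×ᴴ u) ≡ k ×ⁿ proj₁ u
    ×-proj₁ zero    u = ≡.refl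
    ×-proj₁ (suc k) u = ≡.cong (proj₁ u ∙_) (×-proj₁ k u)

    ·-proj₁ : ∀ c u → proj₁ (_·_ (subgroup Γ H) c u) ≡ c ∙ᶻ proj₁ u
    ·-proj₁ (+ k)    u = ×-proj₁ k u
    ·-proj₁ -[1+ k ] u = ≡.cong _⁻¹ (×-proj₁ (suc k) u)

    sum-proj₁ : ∀ {k} (c : Vector ℤ k) u →
                proj₁ (sumᴴ (λ i → _·_ (subgroup Γ H) (c i) (u i))) ≡ sum (λ i → c i ∙ᶻ proj₁ (u i))
    sum-proj₁ {zero}  c u = ≡.refl
    sum-proj₁ {suc k} c u = ≡.cong₂ _∙_ (·-proj₁ (c zero) (u zero)) (sum-proj₁ (c ∘ suc) (u ∘ suc))

  -- When `P` is a span, this says that the class of `x` is a torsion element of the quotient.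
  SomeMultipleIn : Pred Carrier p → Pred Carrier p
  SomeMultipleIn P x = ∃ λ d → 0 < d × P (d ×ⁿ x)

  RankOf-[] : RankOf (⟨_⟩ Γ []) 0
  RankOf-[] = rankOf (independentIn (λ ()) (λ ()) (λ _ _ ())) bound
    where
    trivial : ∀ {x} → ⟨_⟩ Γ [] x → x ≈ ε
    trivial = span-least
      (record { ε-closed  = refl
              ; ∙-closed  = λ d e → trans (∙-cong d e) (identityˡ ε)
              ; ⁻¹-closed = λ d → trans (⁻¹-cong d) ε⁻¹≈ε })
      (λ x≈y d → trans (sym x≈y) d) (λ ())

    bound : ∀ {s} → IndependentIn (⟨_⟩ Γ []) s → s ≤ 0
    bound {zero}  _                        = z≤n
    bound {suc s} (independentIn v Pv ind)
      -- All vectors are trivial, so the relation with every coefficient 1 holds, and independence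
      -- would give 1 = 0.
      with () ← ind (λ _ → 1ℤ)
        (trans (sum-cong-≋ λ i → trans (·-identityˡ (v i)) (trivial (Pv i)))
               (sum-replicate-zero (suc s))) zero

  -- Multiplication by the positive integer `D` carries the larger span into the smaller one. It
  -- preserves independence because `D` can be cancelled in ℤ, so independent families in the larger
  -- span are no longer than those in the smaller.
  RankOf-∷-torsion : ∀ {x} {L : Vec Carrier n} → SomeMultipleIn (⟨_⟩ Γ L) x →
                     RankOf (⟨_⟩ Γ L) k → RankOf (⟨_⟩ Γ (x ∷ L)) k
  RankOf-∷-torsion {x = x} {L} (suc d , _ , dx∈L) (rankOf inL max) =
    rankOf (IndependentIn-mono (span-mono there) inL) bound
    where
    D = + suc d

    scaled : ∀ {y} → ⟨_⟩ Γ (x ∷ L) y → ⟨_⟩ Γ L (D ∙ᶻ y)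
    scaled = span-least
      (record { ε-closed  = resp (sym (·-zeroʳ D)) ε∈
              ; ∙-closed  = λ d e → resp (sym (·-distribˡ-∙ D _ _)) (∙∈ d e)
              ; ⁻¹-closed = λ d → resp (sym (·-negʳ D _)) (⁻¹∈ d) })
      (λ x≈y → resp (·-congˡ D x≈y))
      λ { (here ≡.refl) → dx∈L
        ; (there y∈L)   → ·-closed (spanIsSubgroup L) D (gen y∈L) }

    bound : ∀ {s} → IndependentIn (⟨_⟩ Γ (x ∷ L)) s → s ≤ _
    bound (independentIn v Pv ind) = max (independentIn (λ i → D ∙ᶻ v i) (scaled ∘ Pv)
      λ c eq i → ℤ.*-cancelʳ-≡ (c i) 0ℤ D
        (ind (λ i → c i ℤ.* D) (trans (sum-cong-≋ λ i → ·-assoc (c i) D (v i)) eq) i))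

  -- The coefficient is read off the derivation of membership. The closure cases are congruences in
  -- the quotient by `⟨ L ⟩`, where `y` equals its multiple of `x`.
  coordinate : ∀ {x} {L : Vec Carrier n} {y} → ⟨_⟩ Γ (x ∷ L) y → ∃ λ c → ⟨_⟩ Γ L (y - c ∙ᶻ x)
  coordinate {x = x} {L} = span-least
    (record { ε-closed  = 0ℤ , lift L refl
            ; ∙-closed  = λ {y} {z} (c , d) (c′ , d′) → c ℤ.+ c′ ,
                Q.trans {i = y ∙ z} (Q.∙-cong {y} {c ∙ᶻ x} {z} {c′ ∙ᶻ x} d d′)
                  (lift L (sym (·-distribʳ-+ c c′ x)))
            ; ⁻¹-closed = λ {y} (c , d) → ℤ.- c ,
                Q.trans {i = y ⁻¹} (Q.⁻¹-cong {y} {c ∙ᶻ x} d) (lift L (sym (·-negˡ c x))) })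
    (λ y≈z (c , d) → c , resp (∙-congʳ y≈z) d)
    λ { (here ≡.refl) → 1ℤ , lift L (sym (·-identityˡ x))
      ; (there y∈L)   → 0ℤ , raise L (gen y∈L) }
    where module Q = AbelianGroup (Γ /⟨ L ⟩)

  -- For the lower bound, `x` joins a maximal independent family of `⟨ L ⟩`. For the upper bound, an
  -- independent family either has all `x`-coordinates zero, hence lies in `⟨ L ⟩`, or has a nonzero
  -- coordinate that serves as pivot for one step of fraction-free Gaussian elimination, at the cost
  -- of one vector.
  RankOf-∷-free : ∀ {x} {L : Vec Carrier n} → ¬ SomeMultipleIn (⟨_⟩ Γ L) x →
                  RankOf (⟨_⟩ Γ L) k → RankOf (⟨_⟩ Γ (x ∷ L)) (suc k)
  RankOf-∷-free {k = k} {x = x} {L} x-free (rankOf (independentIn v Pv ind) max) =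
    rankOf (independentIn x∷v x∷v∈ x∷v-ind) bound
    where
    x∷v : Vector Carrier (suc k)
    x∷v zero    = x
    x∷v (suc i) = v i

    x∷v∈ : ∀ i → ⟨_⟩ Γ (x ∷ L) (x∷v i)
    x∷v∈ zero    = gen (here ≡.refl)
    x∷v∈ (suc i) = span-mono there (Pv i)

    coefficient≡0 : ∀ c → ⟨_⟩ Γ L (c ∙ᶻ x) → c ≡ 0ℤ
    coefficient≡0 (+ zero)  _ = ≡.refl
    coefficient≡0 (+ suc d) h = contradiction (suc d , s≤s z≤n , h) x-free
    coefficient≡0 -[1+ d ]  h =
      contradiction (suc d , s≤s z≤n , resp (⁻¹-involutive _) (⁻¹∈ h)) x-free

    x∷v-ind : Independent Γ x∷v
    x∷v-ind c eq = λ { zero → c₀≡0 ; (suc i) → ind (c ∘ suc) rest≈ε i }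
      where
      rest = sum (λ i → c (suc i) ∙ᶻ v i)
      c₀≡0 : c zero ≡ 0ℤ
      -- The relation makes `c zero ∙ᶻ x` the inverse of `rest`, which lies in `⟨ L ⟩`.
      c₀≡0 = coefficient≡0 (c zero) (resp (sym (inverseˡ-unique _ _ eq))
        (⁻¹∈ (sum-closed (spanIsSubgroup L) _ λ i → ·-closed (spanIsSubgroup L) (c (suc i)) (Pv i))))
      rest≈ε : rest ≈ ε
      rest≈ε = begin
        rest               ≈⟨ identityˡ rest ⟨
        ε ∙ rest           ≈⟨ ∙-congʳ (·-congʳ x c₀≡0) ⟨
        c zero ∙ᶻ x ∙ rest ≈⟨ eq ⟩
        ε                  ∎

    bound : ∀ {s} → IndependentIn (⟨_⟩ Γ (x ∷ L)) s → s ≤ suc k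
    bound {zero}  _ = z≤n
    bound {suc s} (independentIn w w∈ w-ind) with any? (λ i → ¬? (proj₁ (coordinate (w∈ i)) ℤ.≟ 0ℤ))
    ... | no  all-zero = ℕ.≤-trans (max (independentIn w w∈L w-ind)) (ℕ.n≤1+n k)
      where
      w∈L : ∀ i → ⟨_⟩ Γ L (w i)
      w∈L i with coordinate (w∈ i) in eq
      ... | c , d with c ℤ.≟ 0ℤ
      ... | yes ≡.refl = lower L d
      ... | no  c≢0    = contradiction (i , λ c≡0 → c≢0 (≡.trans (≡.sym (≡.cong proj₁ eq)) c≡0)) all-zero
    ... | yes (p , aₚ≢0) = s≤s (max (independentIn w′ w′∈L w′-ind))
      where
      a′ : Vector ℤ (suc s)
      a′ i = proj₁ (coordinate (w∈ i))
      aₚ = a′ p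

      -- Eliminating x with the pivot w p leaves s independent vectors in ⟨ L ⟩.
      w′ : Vector Carrier s
      w′ i = aₚ ∙ᶻ w (punchIn p i) ∙ (ℤ.- a′ (punchIn p i)) ∙ᶻ w p

      -- The two occurrences of `x` have total coefficients `- (b c)` and `c b`.
      cross-terms : ∀ b c → b ∙ᶻ ((c ∙ᶻ x) ⁻¹) ∙ (ℤ.- c) ∙ᶻ ((b ∙ᶻ x) ⁻¹) ≈ ε
      cross-terms b c = begin
        b ∙ᶻ ((c ∙ᶻ x) ⁻¹) ∙ (ℤ.- c) ∙ᶻ ((b ∙ᶻ x) ⁻¹)  ≈⟨ ∙-cong (·-negʳ b _) (·-negˡ c _) ⟩
        (b ∙ᶻ (c ∙ᶻ x)) ⁻¹ ∙ (c ∙ᶻ ((b ∙ᶻ x) ⁻¹)) ⁻¹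
          ≈⟨ ∙-cong (⁻¹-cong (sym (·-assoc b c x)))
                    (⁻¹-cong (trans (·-negʳ c _) (⁻¹-cong (sym (·-assoc c b x))))) ⟩
        ((b ℤ.* c) ∙ᶻ x) ⁻¹ ∙ (((c ℤ.* b) ∙ᶻ x) ⁻¹) ⁻¹ ≈⟨ ∙-congˡ (⁻¹-involutive _) ⟩
        ((b ℤ.* c) ∙ᶻ x) ⁻¹ ∙ (c ℤ.* b) ∙ᶻ x           ≈⟨ ∙-congˡ (·-congʳ x (ℤ.*-comm c b)) ⟩
        ((b ℤ.* c) ∙ᶻ x) ⁻¹ ∙ (b ℤ.* c) ∙ᶻ x           ≈⟨ inverseˡ _ ⟩
        ε                                              ∎

      w′∈L : ∀ i → ⟨_⟩ Γ L (w′ i)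
      w′∈L i = resp (begin
        aₚ ∙ᶻ (w j - a′ j ∙ᶻ x) ∙ (ℤ.- a′ j) ∙ᶻ (w p - aₚ ∙ᶻ x)
          ≈⟨ ∙-cong (·-distribˡ-∙ aₚ _ _) (·-distribˡ-∙ (ℤ.- a′ j) _ _) ⟩
        (aₚ ∙ᶻ w j ∙ aₚ ∙ᶻ ((a′ j ∙ᶻ x) ⁻¹)) ∙ ((ℤ.- a′ j) ∙ᶻ w p ∙ (ℤ.- a′ j) ∙ᶻ ((aₚ ∙ᶻ x) ⁻¹))
          ≈⟨ interchange _ _ _ _ ⟩
        w′ i ∙ (aₚ ∙ᶻ ((a′ j ∙ᶻ x) ⁻¹) ∙ (ℤ.- a′ j) ∙ᶻ ((aₚ ∙ᶻ x) ⁻¹))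
          ≈⟨ ∙-congˡ (cross-terms aₚ (a′ j)) ⟩
        w′ i ∙ ε
          ≈⟨ identityʳ _ ⟩
        w′ i ∎)
        (∙∈ (·-closed (spanIsSubgroup L) aₚ (proj₂ (coordinate (w∈ j))))
            (·-closed (spanIsSubgroup L) (ℤ.- a′ j) (proj₂ (coordinate (w∈ p)))))
        where j = punchIn p i

      -- A relation among the `w′ i` with coefficients `c i` expands to one among the `w j` whose
      -- coefficients away from the pivot are `c i ℤ.* aₚ`. These vanish by independence of `w`, and
      -- `aₚ` is nonzero.
      w′-ind : Independent Γ w′
      w′-ind c eq i = ℤ.*-cancelʳ-≡ (c i) 0ℤ aₚ {{ℤ.≢-nonZero aₚ≢0}}
        (≡.trans (≡.sym (insertAt-punchIn c′ p e i)) (w-ind d sum-d (punchIn p i)))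
        where
        c′ : Vector ℤ s
        c′ i = c i ℤ.* aₚ
        c-p : Vector ℤ s
        c-p i = c i ℤ.* (ℤ.- a′ (punchIn p i))
        e = proj₁ (sum-multiples c-p (w p))
        d = insertAt c′ p e

        sum-d : sum (λ j → d j ∙ᶻ w j) ≈ ε
        sum-d = begin
          sum (λ j → d j ∙ᶻ w j)
            ≈⟨ sum-remove {i = p} (λ j → d j ∙ᶻ w j) ⟩
          d p ∙ᶻ w p ∙ sum (λ i → d (punchIn p i) ∙ᶻ w (punchIn p i))
            ≈⟨ ∙-cong (·-congʳ (w p) (insertAt-lookup c′ p e))
                      (sum-cong-≋ λ i → ·-congʳ (w (punchIn p i)) (insertAt-punchIn c′ p e i)) ⟩
          e ∙ᶻ w p ∙ sum (λ i → c′ i ∙ᶻ w (punchIn p i))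
            ≈⟨ ∙-congʳ (proj₂ (sum-multiples c-p (w p))) ⟨
          sum (λ i → c-p i ∙ᶻ w p) ∙ sum (λ i → c′ i ∙ᶻ w (punchIn p i))
            ≈⟨ comm _ _ ⟩
          sum (λ i → c′ i ∙ᶻ w (punchIn p i)) ∙ sum (λ i → c-p i ∙ᶻ w p)
            ≈⟨ ∑-distrib-+ (λ i → c′ i ∙ᶻ w (punchIn p i)) (λ i → c-p i ∙ᶻ w p) ⟨
          sum (λ i → c′ i ∙ᶻ w (punchIn p i) ∙ c-p i ∙ᶻ w p)
            ≈⟨ sum-cong-≋ (λ i → trans (∙-cong (·-assoc (c i) aₚ _) (·-assoc (c i) _ (w p)))
                                       (sym (·-distribˡ-∙ (c i) _ _))) ⟩
          sum (λ i → c i ∙ᶻ w′ i)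
            ≈⟨ eq ⟩
          ε ∎

-- Combined with uniqueness of the number, this evaluates `theNumber` whichever witness excluded
-- middle returns.
theNumber-satisfies : (em : Classical) {P : Pred ℕ p} → ∃ P → P (theNumber em P)
theNumber-satisfies em {P} ∃P with em {P = ∃ P}
... | yes (_ , Pk) = Pk
... | no  ∄P       = contradiction ∃P ∄P

HasRank-unique : (Γ : AbelianGroup a α) → HasRank Γ k → HasRank Γ m → k ≡ m
HasRank-unique Γ ((v , v-ind) , v-max) ((w , w-ind) , w-max) =
  ℕ.≤-antisym (w-max v v-ind) (v-max w w-ind)

-- Spans and ranks in a quotient by a span

module _ (Γ : AbelianGroup a α) (L : Vec (AbelianGroup.Carrier Γ) n) where
  open AbelianGroup Γ
  open RawMonoidOps rawMonoid using () renaming (_×_ to _×ⁿ_)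
  open AbelianGroupProperties Γ using (⁻¹-anti-homo‿-)
  open IntegerMultiples Γ

  private
    Γ/L = Γ /⟨ L ⟩
    module Q = AbelianGroup Γ/L
    module QZ = IntegerMultiples Γ/L
  open RawMonoidOps Q.rawMonoid using () renaming (_×_ to _×/_)

  -- Elements equal in the quotient differ by an element of `⟨ L ⟩`, which the appended generators
  -- absorb.
  span-/⇒++ : (M : Vec Carrier m) → ⟨_⟩ Γ/L M ⊆ ⟨_⟩ Γ (M ++ L)
  span-/⇒++ M = QZ.span-least
    (record { ε-closed = ε∈ ; ∙-closed = ∙∈ ; ⁻¹-closed = ⁻¹∈ })
    (λ {x} {y} x-y∈L x∈ → resp (begin
      (x - y) ⁻¹ ∙ x       ≈⟨ ∙-congʳ (⁻¹-anti-homo‿- x y) ⟩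
      (y - x) ∙ x          ≈⟨ assoc y (x ⁻¹) x ⟩
      y ∙ (x ⁻¹ ∙ x)       ≈⟨ ∙-congˡ (inverseˡ x) ⟩
      y ∙ ε                ≈⟨ identityʳ y ⟩
      y                    ∎)
      (∙∈ (⁻¹∈ (span-mono (∈-++⁺ʳ M) x-y∈L)) x∈))
    (λ x∈M → gen (∈-++⁺ˡ x∈M))
    where open SetoidReasoning setoid

  -- Generators taken from `L` become `ε` in the quotient and so lie in every span there.
  span-++⇒/ : (M : Vec Carrier m) → ⟨_⟩ Γ (M ++ L) ⊆ ⟨_⟩ Γ/L M
  span-++⇒/ M = span-least
    (record { ε-closed = ε∈ ; ∙-closed = ∙∈ ; ⁻¹-closed = ⁻¹∈ })
    (λ x≈y → resp (lift L x≈y))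
    (generators M)
    where
    generators : (M : Vec Carrier m) → ∀ {x} → x ∈ M ++ L → ⟨_⟩ Γ/L M x
    generators []      {x} x∈L            = resp (Q.sym {x} {ε} (raise L (gen x∈L))) ε∈
    generators (y ∷ M)     (here ≡.refl)  = gen (here ≡.refl)
    generators (y ∷ M)     (there x∈M++L) = QZ.span-mono there (generators M x∈M++L)

  -- Not definitional, because _×_ is parametrised by the whole raw monoid.
  ×-quotient : ∀ k x → k ×/ x ≡ k ×ⁿ x
  ×-quotient zero    x = ≡.refl
  ×-quotient (suc k) x = ≡.cong (x ∙_) (×-quotient k x)

  -- One case distinction per generator serves both ranks: the two inclusions of spans turn torsion
  -- modulo `⟨ M ++ L ⟩` in `Γ` into torsion modulo `⟨ M ⟩` in the quotient.
  RankOf-++ : Classical → RankOf Γ (⟨_⟩ Γ L) k → (M : Vec Carrier m) →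
              ∃ λ j → j ≤ m × RankOf Γ/L (⟨_⟩ Γ/L M) j × RankOf Γ (⟨_⟩ Γ (M ++ L)) (j ℕ.+ k)
  RankOf-++ em rank-L [] = 0 , z≤n , RankOf-[] Γ/L , rank-L
  RankOf-++ em rank-L (x ∷ M)
    with RankOf-++ em rank-L M | em {P = SomeMultipleIn Γ (⟨_⟩ Γ (M ++ L)) x}
  ... | j , j≤m , rank-M , rank-M++L | yes tor@(d , 0<d , dx∈) =
    j , ℕ.m≤n⇒m≤1+n j≤m ,
    RankOf-∷-torsion Γ/L
      (d , 0<d , ≡.subst (⟨_⟩ Γ/L M) (≡.sym (×-quotient d x)) (span-++⇒/ M dx∈)) rank-M ,
    RankOf-∷-torsion Γ tor rank-M++L
  ... | j , j≤m , rank-M , rank-M++L | no free =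
    suc j , s≤s j≤m ,
    RankOf-∷-free Γ/L
      (λ (d , 0<d , dx∈) →
        free (d , 0<d , ≡.subst (⟨_⟩ Γ (M ++ L)) (×-quotient d x) (span-/⇒++ M dx∈))) rank-M ,
    RankOf-∷-free Γ free rank-M++L

-- Conversion checking would otherwise unfold ranks and multiplicities down to
-- the excluded middle oracle.
opaque
  rk : Classical → (Γ : AbelianGroup a α) → Vec (AbelianGroup.Carrier Γ) n → ℕ
  rk em Γ L = r⟨_⟩ em Γ L

  mult : Classical → (Γ : AbelianGroup a α) → Vec (AbelianGroup.Carrier Γ) n → AbelianGroup g γ → ℕ
  mult em Γ L G = multiplicity em Γ L G

-- Existence and additivity of the rank

module Ranks (em : Classical) where
  module _ (Γ : AbelianGroup a α) where
    open AbelianGroup Γ using (Carrier)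
    open IntegerMultiples Γ using (spanIsSubgroup)

    span-rank : (L : Vec Carrier n) → ∃ λ k → k ≤ n × RankOf Γ (⟨_⟩ Γ L) k
    span-rank [] = 0 , z≤n , RankOf-[] Γ
    span-rank (x ∷ L) with span-rank L | em {P = SomeMultipleIn Γ (⟨_⟩ Γ L) x}
    ... | k , k≤n , rank-L | yes tor  = k , ℕ.m≤n⇒m≤1+n k≤n , RankOf-∷-torsion Γ tor rank-L
    ... | k , k≤n , rank-L | no  free = suc k , s≤s k≤n , RankOf-∷-free Γ free rank-L

    opaque
      unfolding rk

      rk≡ : {L : Vec Carrier n} → RankOf Γ (⟨_⟩ Γ L) k → rk em Γ L ≡ k
      rk≡ {k = k} {L = L} rank-L =
        HasRank-unique (⟨_⟩-group Γ L) (theNumber-satisfies em {HasRank (⟨_⟩-group Γ L)} (k , has)) has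
        where
        has : HasRank (⟨_⟩-group Γ L) k
        has = RankOf⇒HasRank Γ (spanIsSubgroup L) rank-L

    rk≤length : (L : Vec Carrier n) → rk em Γ L ≤ n
    rk≤length L with span-rank L
    ... | k , k≤n , rank-L rewrite rk≡ rank-L = k≤n

    rk-mono : (L : Vec Carrier m) (M : Vec Carrier n) → ⟨_⟩ Γ L ⊆ ⟨_⟩ Γ M → rk em Γ L ≤ rk em Γ M
    rk-mono L M L⊆M with span-rank L | span-rank M
    ... | k , _ , rank-L | l , _ , rank-M rewrite rk≡ rank-L | rk≡ rank-M =
      RankOf-mono Γ L⊆M rank-L rank-M

    rk-cong : (L : Vec Carrier m) (M : Vec Carrier n) →
               ⟨_⟩ Γ L ⊆ ⟨_⟩ Γ M → ⟨_⟩ Γ M ⊆ ⟨_⟩ Γ L → rk em Γ L ≡ rk em Γ M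
    rk-cong L M L⊆M M⊆L = ℕ.≤-antisym (rk-mono L M L⊆M) (rk-mono M L M⊆L)

  module _ (Γ : AbelianGroup a α) where
    open AbelianGroup Γ using (Carrier)

    rk-++ : (L : Vec Carrier n) (M : Vec Carrier m) →
             rk em Γ (M ++ L) ≡ rk em Γ L ℕ.+ rk em (Γ /⟨ L ⟩) M
    rk-++ L M with span-rank Γ L
    ... | k , _ , rank-L with RankOf-++ Γ L em rank-L M
    ... | j , _ , rank-M , rank-M++L rewrite rk≡ Γ rank-L | rk≡ Γ rank-M++L =
      ≡.trans (ℕ.+-comm j k) (≡.cong (k ℕ.+_) (≡.sym (rk≡ (Γ /⟨ L ⟩) rank-M)))

-- Cardinalities

HasCardinality-unique : {S : Setoid a α} {S′ : Setoid b β} →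
                        Inverse S S′ → HasCardinality S k → HasCardinality S′ m → k ≡ m
HasCardinality-unique S≅S′ S≅k S′≅m =
  ↔⇒≡ (Composition.inverse (Symmetry.inverse S≅k) (Composition.inverse S≅S′ S′≅m))

module _ (em : Classical) (S : Setoid a α) where
  open Setoid S

  -- Excluded middle decides whether a value already occurs up to `≈`. This turns a surjective
  -- enumeration into the bijective one that `Finite` demands.
  withoutRepetitions : ∀ k (f : Fin k → Carrier) →
    Σ ℕ λ c → Σ (Fin c → Carrier) λ h →
      (∀ i j → h i ≈ h j → i ≡ j) × (∀ i → ∃ λ j → h j ≈ f i)
  withoutRepetitions zero    f = 0 , (λ ()) , (λ ()) , (λ ())
  withoutRepetitions (suc k) f
    with withoutRepetitions k (f ∘ suc)
  ... | c , h , h-inj , h-onto with em {P = ∃ λ j → h j ≈ f zero}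
  ...   | yes old = c , h , h-inj , λ { zero → old ; (suc i) → h-onto i }
  ...   | no  new = suc c , h′ , h′-inj ,
    λ { zero → zero , refl ; (suc i) → suc (proj₁ (h-onto i)) , proj₂ (h-onto i) }
    where
    h′ : Fin (suc c) → Carrier
    h′ zero    = f zero
    h′ (suc j) = h j

    h′-inj : ∀ i j → h′ i ≈ h′ j → i ≡ j
    h′-inj zero    zero    _ = ≡.refl
    h′-inj zero    (suc j) e = contradiction (j , sym e) new
    h′-inj (suc i) zero    e = contradiction (i , e) new
    h′-inj (suc i) (suc j) e = ≡.cong suc (h-inj i j e)

  -- A retract of a finite set is finite; `cardinality-×` uses this to pass from a finite product to
  -- its factors. The map `index` respects equality because `h` is injective, whatever `g` does.
  finite-image : (f : Fin k → Carrier) (g : Carrier → Fin k) → (∀ x → f (g x) ≈ x) → Finite S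
  finite-image {k = k} f g f∘g≈id with withoutRepetitions k f
  ... | c , h , h-inj , h-onto = c , record
    { to        = index
    ; from      = h
    ; to-cong   = λ {x} {y} x≈y → h-inj _ _ (trans (h-index x) (trans x≈y (sym (h-index y))))
    ; from-cong = λ { ≡.refl → refl }
    ; inverse   = (λ {i} {x} x≈hi → h-inj _ _ (trans (h-index x) x≈hi)) ,
                  (λ { {x} ≡.refl → h-index x })
    }
    where
    index : Carrier → Fin c
    index x = proj₁ (h-onto (g x))

    h-index : ∀ x → h (index x) ≈ x
    h-index x = trans (proj₂ (h-onto (g x))) (f∘g≈id x)

module Cardinality (em : Classical) where

  cardinality≡ : {S : Setoid a α} → HasCardinality S k → cardinality em S ≡ k
  cardinality≡ {S = S} S≅k =
    HasCardinality-unique (Identity.inverse S) (theNumber-satisfies em {HasCardinality S} (_ , S≅k)) S≅k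

  cardinality-infinite : {S : Setoid a α} → ¬ Finite S → cardinality em S ≡ 0
  cardinality-infinite {S = S} ¬fin with em {P = Finite S}
  ... | yes fin = contradiction fin ¬fin
  ... | no  _   = ≡.refl

  -- If one side is infinite, so is the other, and both cardinalities take the default value 0. The
  -- case split is on the instance of excluded middle inside `cardinality em S′`, so it also
  -- evaluates the right-hand side.
  cardinality-cong : {S : Setoid a α} {S′ : Setoid b β} → Inverse S S′ →
                     cardinality em S ≡ cardinality em S′
  cardinality-cong {S = S} {S′} S≅S′ with em {P = Finite S′}
  ... | yes (k , S′≅k) = cardinality≡ (Composition.inverse S≅S′ S′≅k)
  ... | no  ¬fin       = cardinality-infinite λ (k , S≅k) →
    ¬fin (k , Composition.inverse (Symmetry.inverse S≅S′) S≅k)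

  -- Infinite setoids have cardinality 0 by convention, so a product is infinite
  -- iff one factor has cardinality 0, provided that both factors are inhabited.
  cardinality-× : (S : Setoid a α) (S′ : Setoid b β) → Setoid.Carrier S → Setoid.Carrier S′ →
                  cardinality em (×-setoid S S′) ≡ cardinality em S ℕ.* cardinality em S′
  cardinality-× S S′ s₀ s₀′ with em {P = Finite S} | em {P = Finite S′}
  ... | yes (k , S≅k) | yes (m , S′≅m) =
    cardinality≡ (Composition.inverse (S≅k ×-inverse S′≅m)
      (Composition.inverse ×-≡ (Symmetry.inverse *↔×)))
    where
    ×-≡ : Inverse (×-setoid (≡.setoid (Fin k)) (≡.setoid (Fin m))) (≡.setoid (Fin k × Fin m))
    ×-≡ = Pointwise-≡↔≡
  ... | yes (k , _) | no ¬fin = ≡.trans (cardinality-infinite λ (l , ×≅l) →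
      ¬fin (finite-image em S′ (λ i → proj₂ (Inverse.from ×≅l i)) (λ x → Inverse.to ×≅l (s₀ , x))
        (λ x → proj₂ (Inverse.strictlyInverseʳ ×≅l (s₀ , x)))))
      (≡.sym (ℕ.*-zeroʳ k))
  ... | no ¬fin | _ = cardinality-infinite λ (l , ×≅l) →
      ¬fin (finite-image em S (λ i → proj₁ (Inverse.from ×≅l i)) (λ x → Inverse.to ×≅l (x , s₀′))
        (λ x → proj₁ (Inverse.strictlyInverseʳ ×≅l (x , s₀′))))

-- Multiplicities

module _ (H : AbelianGroup a α) where
  private module H = AbelianGroup H

  -- Provides the inhabitants of the Hom-setoids that `cardinality-×` asks for.
  zeroHom : (G : AbelianGroup g γ) → GroupHomomorphism H.rawGroup (AbelianGroup.rawGroup G)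
  zeroHom G = record
    { ⟦_⟧ = λ _ → ε
    ; isGroupHomomorphism = record
      { isMonoidHomomorphism = record
        { isMagmaHomomorphism = record
          { isRelHomomorphism = record { cong = λ _ → refl }
          ; homo = λ _ _ → sym (identityˡ ε) }
        ; ε-homo = refl }
      ; ⁻¹-homo = λ _ → sym ε⁻¹≈ε }
    }
    where
    open AbelianGroup G
    open AbelianGroupProperties G using (ε⁻¹≈ε)

  Hom-product : (G₁ : AbelianGroup g γ) (G₂ : AbelianGroup g′ ℓ) →
                Inverse (Hom H (abelianGroup G₁ G₂)) (×-setoid (Hom H G₁) (Hom H G₂))
  Hom-product G₁ G₂ = record
    { to        = λ φ → projection₁ φ , projection₂ φ
    ; from      = λ (φ₁ , φ₂) → pairing φ₁ φ₂
    ; to-cong   = λ φ≈ψ → (λ x → proj₁ (φ≈ψ x)) , (λ x → proj₂ (φ≈ψ x))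
    ; from-cong = λ (φ≈ψ₁ , φ≈ψ₂) x → φ≈ψ₁ x , φ≈ψ₂ x
    ; inverse   = (λ e → (λ x → proj₁ (e x)) , (λ x → proj₂ (e x))) , (λ (e₁ , e₂) x → e₁ x , e₂ x)
    }
    where
    module G₁ = AbelianGroup G₁
    module G₂ = AbelianGroup G₂
    module G₁₂ = AbelianGroup (abelianGroup G₁ G₂)
    open GroupHomomorphism

    projection₁ : GroupHomomorphism H.rawGroup G₁₂.rawGroup → GroupHomomorphism H.rawGroup G₁.rawGroup
    projection₁ φ = record
      { ⟦_⟧ = λ x → proj₁ (⟦ φ ⟧ x)
      ; isGroupHomomorphism = record
        { isMonoidHomomorphism = record
          { isMagmaHomomorphism = record
            { isRelHomomorphism = record { cong = λ e → proj₁ (⟦⟧-cong φ e) }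
            ; homo = λ x y → proj₁ (homo φ x y) }
          ; ε-homo = proj₁ (ε-homo φ) }
        ; ⁻¹-homo = λ x → proj₁ (⁻¹-homo φ x) }
      }

    projection₂ : GroupHomomorphism H.rawGroup G₁₂.rawGroup → GroupHomomorphism H.rawGroup G₂.rawGroup
    projection₂ φ = record
      { ⟦_⟧ = λ x → proj₂ (⟦ φ ⟧ x)
      ; isGroupHomomorphism = record
        { isMonoidHomomorphism = record
          { isMagmaHomomorphism = record
            { isRelHomomorphism = record { cong = λ e → proj₂ (⟦⟧-cong φ e) }
            ; homo = λ x y → proj₂ (homo φ x y) }
          ; ε-homo = proj₂ (ε-homo φ) }
        ; ⁻¹-homo = λ x → proj₂ (⁻¹-homo φ x) }
      }

    pairing : GroupHomomorphism H.rawGroup G₁.rawGroup → GroupHomomorphism H.rawGroup G₂.rawGroup →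
              GroupHomomorphism H.rawGroup G₁₂.rawGroup
    pairing φ₁ φ₂ = record
      { ⟦_⟧ = λ x → ⟦ φ₁ ⟧ x , ⟦ φ₂ ⟧ x
      ; isGroupHomomorphism = record
        { isMonoidHomomorphism = record
          { isMagmaHomomorphism = record
            { isRelHomomorphism = record { cong = λ e → ⟦⟧-cong φ₁ e , ⟦⟧-cong φ₂ e }
            ; homo = λ x y → homo φ₁ x y , homo φ₂ x y }
          ; ε-homo = ε-homo φ₁ , ε-homo φ₂ }
        ; ⁻¹-homo = λ x → ⁻¹-homo φ₁ x , ⁻¹-homo φ₂ x }
      }

module _ {H : AbelianGroup a α} {H′ : AbelianGroup b β} where
  private
    module H  = AbelianGroup H
    module H′ = AbelianGroup H′
  open GroupHomomorphism

  Hom-precompose : (ι : GroupHomomorphism H.rawGroup H′.rawGroup)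
                   (κ : GroupHomomorphism H′.rawGroup H.rawGroup) →
                   (∀ x → ⟦ κ ⟧ (⟦ ι ⟧ x) H.≈ x) → (∀ y → ⟦ ι ⟧ (⟦ κ ⟧ y) H′.≈ y) →
                   (G : AbelianGroup g γ) → Inverse (Hom H G) (Hom H′ G)
  Hom-precompose ι κ κ∘ι ι∘κ G = record
    { to        = λ φ → groupHomomorphism {M₁ = H′.group} {H.group} {G.group} κ φ
    ; from      = λ φ → groupHomomorphism {M₁ = H.group} {H′.group} {G.group} ι φ
    ; to-cong   = λ φ≈ψ y → φ≈ψ (⟦ κ ⟧ y)
    ; from-cong = λ φ≈ψ x → φ≈ψ (⟦ ι ⟧ x)
    ; inverse   = (λ {φ} e y → G.trans (e (⟦ κ ⟧ y)) (⟦⟧-cong φ (ι∘κ y))) ,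
                  (λ {φ} e x → G.trans (e (⟦ ι ⟧ x)) (⟦⟧-cong φ (κ∘ι x)))
    }
    where module G = AbelianGroup G

module _ (Γ : AbelianGroup a α) where
  open AbelianGroup Γ using (Carrier)

  -- A form of the third isomorphism theorem. Both quotients keep the carrier of `Γ`, and the
  -- hypotheses make their equalities coincide, so `ι` and `κ` fix representatives and only
  -- transport the proofs of torsion.
  Hom-torsion-/ : (L : Vec Carrier n) (M : Vec Carrier m) (V : Vec Carrier k) →
                  ⟨_⟩ (Γ /⟨ L ⟩) M ⊆ ⟨_⟩ Γ V → ⟨_⟩ Γ V ⊆ ⟨_⟩ (Γ /⟨ L ⟩) M →
                  (G : AbelianGroup g γ) →
                  Inverse (Hom (torsion ((Γ /⟨ L ⟩) /⟨ M ⟩)) G) (Hom (torsion (Γ /⟨ V ⟩)) G)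
  Hom-torsion-/ L M V M⊆V V⊆M = Hom-precompose {H = tors/} {H′ = tors} ι κ
    (λ (x , _) → Q.refl {x}) (λ (x , _) → R.refl {x})
    where
    tors/ = torsion ((Γ /⟨ L ⟩) /⟨ M ⟩)
    tors = torsion (Γ /⟨ V ⟩)
    module tors/ = AbelianGroup tors/
    module tors = AbelianGroup tors
    module Q = AbelianGroup ((Γ /⟨ L ⟩) /⟨ M ⟩)
    module R = AbelianGroup (Γ /⟨ V ⟩)
    open AbelianGroup Γ using (_-_; ε)

    ×-/ : ∀ d x → RawMonoidOps._×_ Q.rawMonoid d x ≡ RawMonoidOps._×_ R.rawMonoid d x
    ×-/ d x = ≡.trans (×-quotient (Γ /⟨ L ⟩) M d x)
      (≡.trans (×-quotient Γ L d x) (≡.sym (×-quotient Γ V d x)))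

    ι : GroupHomomorphism tors/.rawGroup tors.rawGroup
    ι = record
      { ⟦_⟧ = λ (x , d , 0<d , dx∈) → x , d , 0<d ,
                ≡.subst (λ y → ⟨_⟩ Γ V (y - ε)) (×-/ d x) (M⊆V dx∈)
      ; isGroupHomomorphism = record
        { isMonoidHomomorphism = record
          { isMagmaHomomorphism = record
            { isRelHomomorphism = record { cong = M⊆V }
            ; homo = λ (x , _) (y , _) → R.refl {x R.∙ y} }
          ; ε-homo = R.refl {ε} }
        ; ⁻¹-homo = λ (x , _) → R.refl {x R.⁻¹} }
      }

    κ : GroupHomomorphism tors.rawGroup tors/.rawGroup
    κ = record
      { ⟦_⟧ = λ (x , d , 0<d , dx∈) → x , d , 0<d ,
                ≡.subst (λ y → ⟨_⟩ (Γ /⟨ L ⟩) M (y - ε)) (≡.sym (×-/ d x)) (V⊆M dx∈)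
      ; isGroupHomomorphism = record
        { isMonoidHomomorphism = record
          { isMagmaHomomorphism = record
            { isRelHomomorphism = record { cong = V⊆M }
            ; homo = λ (x , _) (y , _) → Q.refl {x Q.∙ y} }
          ; ε-homo = Q.refl {ε} }
        ; ⁻¹-homo = λ (x , _) → Q.refl {x Q.⁻¹} }
      }

module Multiplicities (em : Classical) (Γ : AbelianGroup a α) where
  open AbelianGroup Γ using (Carrier)
  open Cardinality em

  opaque
    unfolding mult

    mult-× : (L : Vec Carrier n) (G₁ : AbelianGroup g γ) (G₂ : AbelianGroup g′ ℓ) →
             mult em Γ L (abelianGroup G₁ G₂) ≡ mult em Γ L G₁ ℕ.* mult em Γ L G₂
    mult-× L G₁ G₂ = ≡.trans (cardinality-cong (Hom-product (torsion (Γ /⟨ L ⟩)) G₁ G₂))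
      (cardinality-× _ _ (zeroHom (torsion (Γ /⟨ L ⟩)) G₁) (zeroHom (torsion (Γ /⟨ L ⟩)) G₂))

    mult-/ : (L : Vec Carrier n) (M : Vec Carrier m) (V : Vec Carrier k) →
             ⟨_⟩ (Γ /⟨ L ⟩) M ⊆ ⟨_⟩ Γ V → ⟨_⟩ Γ V ⊆ ⟨_⟩ (Γ /⟨ L ⟩) M →
             (G : AbelianGroup g γ) → mult em (Γ /⟨ L ⟩) M G ≡ mult em Γ V G
    mult-/ L M V M⊆V V⊆M G = cardinality-cong (Hom-torsion-/ Γ L M V M⊆V V⊆M G)

-- Sums over pairs of nested subsets

-- choose B ranges over the subsets of B and extend B over the subsets containing B.
choose : (B : Subset n) → Subset ∣ B ∣ → Subset n
choose []            []      = []
choose (inside  ∷ B) (b ∷ S) = b ∷ choose B S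
choose (outside ∷ B) S       = outside ∷ choose B S

extend : (B : Subset n) → Subset ∣ ∁ B ∣ → Subset n
extend []            []      = []
extend (inside  ∷ B) U       = inside ∷ extend B U
extend (outside ∷ B) (b ∷ U) = b ∷ extend B U

module _ {X : Set a} where

  sublist-⊆ : (S : Subset n) (xs : Vec X n) {x : X} → x ∈ sublist S xs → x ∈ xs
  sublist-⊆ (inside  ∷ S) (y ∷ xs) (here eq) = here eq
  sublist-⊆ (inside  ∷ S) (y ∷ xs) (there i) = there (sublist-⊆ S xs i)
  sublist-⊆ (outside ∷ S) (y ∷ xs) i         = there (sublist-⊆ S xs i)

  sublist-split : (B : Subset n) (xs : Vec X n) {x : X} →
                  x ∈ xs → x ∈ sublist (∁ B) xs ⊎ x ∈ sublist B xs
  sublist-split (inside  ∷ B) (y ∷ xs) (here eq) = inj₂ (here eq)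
  sublist-split (inside  ∷ B) (y ∷ xs) (there i) = Sum.map₂ there (sublist-split B xs i)
  sublist-split (outside ∷ B) (y ∷ xs) (here eq) = inj₁ (here eq)
  sublist-split (outside ∷ B) (y ∷ xs) (there i) = Sum.map₁ there (sublist-split B xs i)

  -- Stated in the total space of Vec X because the lengths agree only propositionally.
  sublist-choose : (B : Subset n) (S : Subset ∣ B ∣) (xs : Vec X n) →
                   _≡_ {A = Σ ℕ (Vec X)}
                     (∣ S ∣ , sublist S (sublist B xs)) (∣ choose B S ∣ , sublist (choose B S) xs)
  sublist-choose []            []            []       = ≡.refl
  sublist-choose (inside  ∷ B) (inside  ∷ S) (x ∷ xs) =
    ≡.cong (λ (k , ys) → suc k , x ∷ ys) (sublist-choose B S xs)
  sublist-choose (inside  ∷ B) (outside ∷ S) (x ∷ xs) = sublist-choose B S xs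
  sublist-choose (outside ∷ B) S             (x ∷ xs) = sublist-choose B S xs

  -- The sublist at `extend B U` interleaves the other two in the order of `xs`, so it is not their
  -- concatenation. Membership is compared instead, and this determines the span.
  ∈-extend⁻ : (B : Subset n) (U : Subset ∣ ∁ B ∣) (xs : Vec X n) {x : X} →
              x ∈ sublist (extend B U) xs → x ∈ sublist U (sublist (∁ B) xs) ⊎ x ∈ sublist B xs
  ∈-extend⁻ []            []            []       ()
  ∈-extend⁻ (inside  ∷ B) U             (y ∷ xs) (here eq) = inj₂ (here eq)
  ∈-extend⁻ (inside  ∷ B) U             (y ∷ xs) (there i) = Sum.map₂ there (∈-extend⁻ B U xs i)
  ∈-extend⁻ (outside ∷ B) (inside  ∷ U) (y ∷ xs) (here eq) = inj₁ (here eq)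
  ∈-extend⁻ (outside ∷ B) (inside  ∷ U) (y ∷ xs) (there i) = Sum.map₁ there (∈-extend⁻ B U xs i)
  ∈-extend⁻ (outside ∷ B) (outside ∷ U) (y ∷ xs) i         = ∈-extend⁻ B U xs i

  ∈-extend⁺ : (B : Subset n) (U : Subset ∣ ∁ B ∣) (xs : Vec X n) {x : X} →
              x ∈ sublist U (sublist (∁ B) xs) ⊎ x ∈ sublist B xs → x ∈ sublist (extend B U) xs
  ∈-extend⁺ []            []            []       (inj₁ ())
  ∈-extend⁺ []            []            []       (inj₂ ())
  ∈-extend⁺ (inside  ∷ B) U             (y ∷ xs) (inj₁ i)         = there (∈-extend⁺ B U xs (inj₁ i))
  ∈-extend⁺ (inside  ∷ B) U             (y ∷ xs) (inj₂ (here eq)) = here eq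
  ∈-extend⁺ (inside  ∷ B) U             (y ∷ xs) (inj₂ (there i)) = there (∈-extend⁺ B U xs (inj₂ i))
  ∈-extend⁺ (outside ∷ B) (inside  ∷ U) (y ∷ xs) (inj₁ (here eq)) = here eq
  ∈-extend⁺ (outside ∷ B) (inside  ∷ U) (y ∷ xs) (inj₁ (there i)) = there (∈-extend⁺ B U xs (inj₁ i))
  ∈-extend⁺ (outside ∷ B) (inside  ∷ U) (y ∷ xs) (inj₂ i)         = there (∈-extend⁺ B U xs (inj₂ i))
  ∈-extend⁺ (outside ∷ B) (outside ∷ U) (y ∷ xs) i                = ∈-extend⁺ B U xs i

module SubsetSums (R : CommutativeRing r ρ) where
  open CommutativeRing R
  open RawSemiringOps (Semiring.rawSemiring semiring) using (_^_)
  open SemiringExp semiring using (^-homo-*)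
  open CommutativeSemiringSolver commutativeSemiring using (solve; _:=_; _:+_; _:*_; con)
  open CommutativeSemigroupProperties (CommutativeMonoid.commutativeSemigroup +-commutativeMonoid)
    using (interchange)
  open SetoidReasoning setoid

  ∑⊆-cong : ∀ n {f h : Subset n → Carrier} → (∀ S → f S ≈ h S) → ∑⊆ R n f ≈ ∑⊆ R n h
  ∑⊆-cong zero    f≈h = f≈h []
  ∑⊆-cong (suc n) f≈h =
    +-cong (∑⊆-cong n (f≈h ∘ (outside ∷_))) (∑⊆-cong n (f≈h ∘ (inside ∷_)))

  ∑⊆-+ : ∀ n (f h : Subset n → Carrier) → ∑⊆ R n (λ S → f S + h S) ≈ ∑⊆ R n f + ∑⊆ R n h
  ∑⊆-+ zero    f h = refl
  ∑⊆-+ (suc n) f h = trans (+-cong (∑⊆-+ n _ _) (∑⊆-+ n _ _)) (interchange _ _ _ _)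

  ∑⊆-*ˡ : ∀ n z (f : Subset n → Carrier) → ∑⊆ R n (λ S → z * f S) ≈ z * ∑⊆ R n f
  ∑⊆-*ˡ zero    z f = refl
  ∑⊆-*ˡ (suc n) z f = trans (+-cong (∑⊆-*ˡ n z _) (∑⊆-*ˡ n z _)) (sym (distribˡ z _ _))

  -- Written as a difference because this is the form that `x - 1#` and `y - 1#` take when the
  -- argument of `T` is `0#`.
  -1# : Carrier
  -1# = 0# - 1#

  -1+1≈0 : -1# + 1# ≈ 0#
  -1+1≈0 = trans (+-assoc _ _ _) (trans (+-identityˡ _) (-‿inverseˡ 1#))

  -1*-1≈1 : -1# * -1# ≈ 1#
  -1*-1≈1 = begin
    -1# * -1#                     ≈⟨ +-identityʳ _ ⟨
    -1# * -1# + 0#                ≈⟨ +-congˡ -1+1≈0 ⟨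
    -1# * -1# + (-1# + 1#)
      ≈⟨ solve 1 (λ z → z :* z :+ (z :+ con 1) := z :* (z :+ con 1) :+ con 1) refl -1# ⟩
    -1# * (-1# + 1#) + 1#         ≈⟨ +-congʳ (*-congˡ -1+1≈0) ⟩
    -1# * 0# + 1#                 ≈⟨ +-congʳ (zeroʳ _) ⟩
    0# + 1#                       ≈⟨ +-identityˡ _ ⟩
    1#                            ∎

  -1^n*-1^n≈1 : ∀ n → -1# ^ n * -1# ^ n ≈ 1#
  -1^n*-1^n≈1 zero    = *-identityˡ 1#
  -1^n*-1^n≈1 (suc n) = begin
    (-1# * -1# ^ n) * (-1# * -1# ^ n)
      ≈⟨ solve 2 (λ z w → (z :* w) :* (z :* w) := (z :* z) :* (w :* w)) refl -1# (-1# ^ n) ⟩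
    (-1# * -1#) * (-1# ^ n * -1# ^ n)    ≈⟨ *-cong -1*-1≈1 (-1^n*-1^n≈1 n) ⟩
    1# * 1#                              ≈⟨ *-identityˡ 1# ⟩
    1#                                   ∎

  -- A power of -1 is its own inverse, so dividing by it is multiplying by it. This separates a sign
  -- into factors that depend on different subsets.
  -1^[m∸n] : ∀ {m n} → n ≤ m → -1# ^ (m ℕ.∸ n) ≈ -1# ^ m * -1# ^ n
  -1^[m∸n] {m} {n} n≤m = begin
    -1# ^ (m ℕ.∸ n)                            ≈⟨ *-identityʳ _ ⟨
    -1# ^ (m ℕ.∸ n) * 1#                       ≈⟨ *-congˡ (-1^n*-1^n≈1 n) ⟨
    -1# ^ (m ℕ.∸ n) * (-1# ^ n * -1# ^ n)      ≈⟨ *-assoc _ _ _ ⟨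
    (-1# ^ (m ℕ.∸ n) * -1# ^ n) * -1# ^ n      ≈⟨ *-congʳ (^-homo-* -1# (m ℕ.∸ n) n) ⟨
    -1# ^ (m ℕ.∸ n ℕ.+ n) * -1# ^ n            ≡⟨ ≡.cong (λ k → -1# ^ k * -1# ^ n) (ℕ.m∸n+n≡m n≤m) ⟩
    -1# ^ m * -1# ^ n                          ∎

  -- For S ⊆ V the sum of (-1)^|V ∖ B| over S ⊆ B ⊆ V vanishes unless S = V.
  ∑⊆-inversion : ∀ n (f h : Subset n → Carrier) →
    ∑⊆ R n (λ B → (∑⊆ R (∣ B ∣) λ S → f (choose B S)) *
                  (∑⊆ R (∣ ∁ B ∣) λ U → h (extend B U) * -1# ^ ∣ U ∣))
      ≈ ∑⊆ R n (λ S → f S * h S)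
  ∑⊆-inversion zero    f h = *-congˡ (*-identityʳ _)
  ∑⊆-inversion (suc n) f h = begin
    ∑⊆ R n (λ B → F₀ B * (H₀ B + ∑⊆ R (∣ ∁ B ∣) (λ U → h (inside ∷ extend B U) * (-1# * -1# ^ ∣ U ∣)))) +
    ∑⊆ R n (λ B → (F₀ B + F₁ B) * H₁ B)
      ≈⟨ ∑⊆-+ n _ _ ⟨
    ∑⊆ R n (λ B → F₀ B * (H₀ B + ∑⊆ R (∣ ∁ B ∣) (λ U → h (inside ∷ extend B U) * (-1# * -1# ^ ∣ U ∣))) +
                  (F₀ B + F₁ B) * H₁ B)
      ≈⟨ ∑⊆-cong n cancel ⟩
    ∑⊆ R n (λ B → F₀ B * H₀ B + F₁ B * H₁ B)
      ≈⟨ ∑⊆-+ n _ _ ⟩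
    ∑⊆ R n (λ B → F₀ B * H₀ B) + ∑⊆ R n (λ B → F₁ B * H₁ B)
      ≈⟨ +-cong (∑⊆-inversion n _ _) (∑⊆-inversion n _ _) ⟩
    ∑⊆ R (suc n) (λ S → f S * h S) ∎
    where
    F₀ F₁ H₀ H₁ : Subset n → Carrier
    F₀ B = ∑⊆ R (∣ B ∣) (λ S → f (outside ∷ choose B S))
    F₁ B = ∑⊆ R (∣ B ∣) (λ S → f (inside ∷ choose B S))
    H₀ B = ∑⊆ R (∣ ∁ B ∣) (λ U → h (outside ∷ extend B U) * -1# ^ ∣ U ∣)
    H₁ B = ∑⊆ R (∣ ∁ B ∣) (λ U → h (inside ∷ extend B U) * -1# ^ ∣ U ∣)

    -- Here `F₀ B * H₁ B` collects the terms whose first position lies in `V` but not in `S`. It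
    -- occurs with sign -1 when that position is outside the middle subset and with sign +1 when it
    -- is inside.
    cancel : ∀ B → F₀ B * (H₀ B + ∑⊆ R (∣ ∁ B ∣) (λ U → h (inside ∷ extend B U) * (-1# * -1# ^ ∣ U ∣))) +
                   (F₀ B + F₁ B) * H₁ B ≈ F₀ B * H₀ B + F₁ B * H₁ B
    cancel B = begin
      F₀ B * (H₀ B + ∑⊆ R (∣ ∁ B ∣) (λ U → h (inside ∷ extend B U) * (-1# * -1# ^ ∣ U ∣))) +
      (F₀ B + F₁ B) * H₁ B
        ≈⟨ +-congʳ (*-congˡ (+-congˡ (trans
             (∑⊆-cong (∣ ∁ B ∣) λ U → solve 3 (λ u v w → u :* (v :* w) := v :* (u :* w)) refl _ -1# _)
             (∑⊆-*ˡ (∣ ∁ B ∣) -1# _)))) ⟩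
      F₀ B * (H₀ B + -1# * H₁ B) + (F₀ B + F₁ B) * H₁ B
        ≈⟨ solve 5 (λ z f₀ f₁ h₀ h₁ → f₀ :* (h₀ :+ z :* h₁) :+ (f₀ :+ f₁) :* h₁ :=
                                      (f₀ :* h₀ :+ f₁ :* h₁) :+ (z :+ con 1) :* (f₀ :* h₁))
             refl -1# (F₀ B) (F₁ B) (H₀ B) (H₁ B) ⟩
      (F₀ B * H₀ B + F₁ B * H₁ B) + (-1# + 1#) * (F₀ B * H₁ B)
        ≈⟨ +-congˡ (trans (*-congʳ -1+1≈0) (zeroˡ _)) ⟩
      (F₀ B * H₀ B + F₁ B * H₁ B) + 0#
        ≈⟨ +-identityʳ _ ⟩
      F₀ B * H₀ B + F₁ B * H₁ B ∎

-- Ranks and multiplicities of contractions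

module Contraction (em : Classical) (Γ : AbelianGroup a α)
  {n : ℕ} (A : Vec (AbelianGroup.Carrier Γ) n) where
  open IntegerMultiples Γ using (span-mono)
  open Ranks em
  open Multiplicities em Γ

  module _ (B : Subset n) where
    private
      rk/ : ∀ {k} → Vec (AbelianGroup.Carrier Γ) k → ℕ
      rk/ = rk em (Γ /⟨ sublist B A ⟩)

    span-extend⁻ : ∀ U → ⟨_⟩ Γ (sublist (extend B U) A) ⊆
                         ⟨_⟩ Γ (sublist U (sublist (∁ B) A) ++ sublist B A)
    span-extend⁻ U = span-mono ([ ∈-++⁺ˡ , ∈-++⁺ʳ (sublist U (sublist (∁ B) A)) ] ∘ ∈-extend⁻ B U A)

    span-extend⁺ : ∀ U → ⟨_⟩ Γ (sublist U (sublist (∁ B) A) ++ sublist B A) ⊆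
                         ⟨_⟩ Γ (sublist (extend B U) A)
    span-extend⁺ U = span-mono (∈-extend⁺ B U A ∘ ∈-++⁻ (sublist U (sublist (∁ B) A)))

    r-extend : ∀ U → rk em Γ (sublist (extend B U) A) ≡
                     rk em Γ (sublist B A) ℕ.+ rk/ (sublist U (sublist (∁ B) A))
    r-extend U = ≡.trans
      (rk-cong Γ _ (sublist U (sublist (∁ B) A) ++ sublist B A) (span-extend⁻ U) (span-extend⁺ U))
      (rk-++ Γ (sublist B A) (sublist U (sublist (∁ B) A)))

    r-contraction : rk em Γ A ≡ rk em Γ (sublist B A) ℕ.+ rk/ (sublist (∁ B) A)
    r-contraction = ≡.trans
      (rk-cong Γ _ (sublist (∁ B) A ++ sublist B A)
        (span-mono ([ ∈-++⁺ˡ , ∈-++⁺ʳ (sublist (∁ B) A) ] ∘ sublist-split B A))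
        (span-mono ([ sublist-⊆ (∁ B) A , sublist-⊆ B A ] ∘ ∈-++⁻ (sublist (∁ B) A))))
      (rk-++ Γ (sublist B A) (sublist (∁ B) A))

    -- Each rank in `Γ` exceeds its counterpart in the quotient by the rank of `B`, which cancels
    -- from the difference.
    corank-contraction : ∀ U → rk/ (sublist (∁ B) A) ℕ.∸ rk/ (sublist U (sublist (∁ B) A)) ≡
                               rk em Γ A ℕ.∸ rk em Γ (sublist (extend B U) A)
    corank-contraction U rewrite r-contraction | r-extend U =
      ≡.sym (ℕ.[m+n]∸[m+o]≡n∸o (rk em Γ (sublist B A))
        (rk/ (sublist (∁ B) A)) (rk/ (sublist U (sublist (∁ B) A))))

    mult-contraction : ∀ U (G : AbelianGroup g γ) →
      mult em (Γ /⟨ sublist B A ⟩) (sublist U (sublist (∁ B) A)) G ≡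
      mult em Γ (sublist (extend B U) A) G
    mult-contraction U = mult-/ (sublist B A) (sublist U (sublist (∁ B) A)) (sublist (extend B U) A)
      (λ {z} d → span-extend⁺ U {z} (span-/⇒++ Γ (sublist B A) (sublist U (sublist (∁ B) A)) {z} d))
      (λ {z} d → span-++⇒/ Γ (sublist B A) (sublist U (sublist (∁ B) A)) {z} (span-extend⁻ U {z} d))

-- The convolution formula

module Convolution (em : Classical) (Γ : AbelianGroup a α)
  {n : ℕ} (A : Vec (AbelianGroup.Carrier Γ) n)
  (G₁ : AbelianGroup g γ) (G₂ : AbelianGroup g′ ℓ)
  (R : CommutativeRing r ρ) (x y : CommutativeRing.Carrier R) where
  open CommutativeRing R
  open RawSemiringOps (Semiring.rawSemiring semiring) using (_^_) renaming (_×_ to _×ⁿ_)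
  open SemiringExp semiring using (^-homo-*)
  open SemiringMult semiring using (×1-homo-*; ×-assoc-*; ×-congʳ)
  open CommutativeSemiringSolver commutativeSemiring using (solve; _:=_; _:*_)
  open CommutativeSemigroupProperties (CommutativeMonoid.commutativeSemigroup *-commutativeMonoid)
    using () renaming (interchange to *-interchange)
  open SetoidReasoning setoid
  open SubsetSums R
  open Ranks em
  open Multiplicities em Γ
  open Contraction em Γ A

  private
    -- As ring elements, the multiplicities can take part in the semiring identities `shuffle₁`,
    -- `shuffle₂` and `shuffle₃`.
    m₁ m₂ : ∀ {k} → Vec (AbelianGroup.Carrier Γ) k → Carrier
    m₁ L = mult em Γ L G₁ ×ⁿ 1#
    m₂ L = mult em Γ L G₂ ×ⁿ 1#

    shuffle₁ : ∀ u v X Y z → (u * v) * (X * Y) * (z * z) ≈ (u * (z * Y)) * (v * (X * z))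
    shuffle₁ = solve 5 (λ u v X Y z →
      (u :* v) :* (X :* Y) :* (z :* z) := (u :* (z :* Y)) :* (v :* (X :* z))) refl

    shuffle₂ : ∀ u s z Y → u * ((s * z) * Y) ≈ s * (u * (z * Y))
    shuffle₂ = solve 4 (λ u s z Y → u :* ((s :* z) :* Y) := s :* (u :* (z :* Y))) refl

    shuffle₃ : ∀ v X u z s → v * (X * (u * z)) * (s * s) ≈ s * ((v * (X * (s * z))) * u)
    shuffle₃ = solve 5 (λ v X u z s →
      v :* (X :* (u :* z)) :* (s :* s) := s :* ((v :* (X :* (s :* z))) :* u)) refl

  ×≈×1* : ∀ k z → k ×ⁿ z ≈ (k ×ⁿ 1#) * z
  ×≈×1* k z = sym (trans (×-assoc-* k 1# z) (×-congʳ k (*-identityˡ z)))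

  -- The summands of T^G₁_B(0,y) and T^G₂_{A/B}(x,0), up to the factor (-1)^r_B
  -- they share and the sign (-1)^|V ∖ B|, no longer depend on B.
  f : ∀ {k} → Vec (AbelianGroup.Carrier Γ) k → Carrier
  f {k} L = m₁ L * (-1# ^ rk em Γ L * (y - 1#) ^ (k ℕ.∸ rk em Γ L))

  h : ∀ {k} → Vec (AbelianGroup.Carrier Γ) k → Carrier
  h L = m₂ L * ((x - 1#) ^ (rk em Γ A ℕ.∸ rk em Γ L) * -1# ^ rk em Γ L)

  -- Both `f` and `h` carry the sign with exponent `rk em Γ L`, and its square is 1. The
  -- multiplicity factors by `mult-×`.
  summand : ∀ S → let L = sublist S A in
    mult em Γ L (abelianGroup G₁ G₂) ×ⁿ
      ((x - 1#) ^ (rk em Γ A ℕ.∸ rk em Γ L) * (y - 1#) ^ (∣ S ∣ ℕ.∸ rk em Γ L)) ≈ f L * h L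
  summand S = begin
    mult em Γ L (abelianGroup G₁ G₂) ×ⁿ (X * Y)   ≡⟨ ≡.cong (_×ⁿ (X * Y)) (mult-× L G₁ G₂) ⟩
    (mult em Γ L G₁ ℕ.* mult em Γ L G₂) ×ⁿ (X * Y)
      ≈⟨ ×≈×1* (mult em Γ L G₁ ℕ.* mult em Γ L G₂) _ ⟩
    ((mult em Γ L G₁ ℕ.* mult em Γ L G₂) ×ⁿ 1#) * (X * Y)
      ≈⟨ *-congʳ (×1-homo-* (mult em Γ L G₁) (mult em Γ L G₂)) ⟩
    (m₁ L * m₂ L) * (X * Y)
      ≈⟨ *-identityʳ _ ⟨
    (m₁ L * m₂ L) * (X * Y) * 1#
      ≈⟨ *-congˡ (-1^n*-1^n≈1 (rk em Γ L)) ⟨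
    (m₁ L * m₂ L) * (X * Y) * (z * z)
      ≈⟨ shuffle₁ (m₁ L) (m₂ L) X Y z ⟩
    f L * h L ∎
    where
    L = sublist S A
    X = (x - 1#) ^ (rk em Γ A ℕ.∸ rk em Γ L)
    Y = (y - 1#) ^ (∣ S ∣ ℕ.∸ rk em Γ L)
    z = -1# ^ rk em Γ L

  opaque
    unfolding rk mult

    -- Brings `T` into the vocabulary of the opaque `rk` and `mult`; the two forms agree
    -- definitionally only where these are unfolded.
    T-unfold : (Λ : AbelianGroup b β) {k : ℕ} (L : Vec (AbelianGroup.Carrier Λ) k) (G : AbelianGroup p q)
               (u v : Carrier) →
               T em Λ L G R u v ≡ ∑⊆ R k λ S → let L[S] = sublist S L in
                 mult em Λ L[S] G ×ⁿ
                   ((u - 1#) ^ (rk em Λ L ℕ.∸ rk em Λ L[S]) * (v - 1#) ^ (∣ S ∣ ℕ.∸ rk em Λ L[S]))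
    T-unfold Λ L G u v = ≡.refl

  module _ (B : Subset n) where
    private
      σ = -1# ^ rk em Γ (sublist B A)

      rk/ : ∀ {k} → Vec (AbelianGroup.Carrier Γ) k → ℕ
      rk/ = rk em (Γ /⟨ sublist B A ⟩)

    -- At first argument 0 the corank factor is a power of -1, which splits into `σ` and the sign
    -- contained in `f`.
    restriction-summand : ∀ S → let L = sublist S (sublist B A) in
      mult em Γ L G₁ ×ⁿ (-1# ^ (rk em Γ (sublist B A) ℕ.∸ rk em Γ L) * (y - 1#) ^ (∣ S ∣ ℕ.∸ rk em Γ L))
        ≈ σ * f (sublist (choose B S) A)
    restriction-summand S = begin
      mult em Γ L G₁ ×ⁿ (-1# ^ (rk em Γ (sublist B A) ℕ.∸ rk em Γ L) * Y)
        ≈⟨ ×≈×1* (mult em Γ L G₁) _ ⟩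
      m₁ L * (-1# ^ (rk em Γ (sublist B A) ℕ.∸ rk em Γ L) * Y)
        ≈⟨ *-congˡ (*-congʳ (-1^[m∸n] (rk-mono Γ L (sublist B A)
             (IntegerMultiples.span-mono Γ (sublist-⊆ S (sublist B A)))))) ⟩
      m₁ L * ((σ * -1# ^ rk em Γ L) * Y)
        ≈⟨ shuffle₂ (m₁ L) σ (-1# ^ rk em Γ L) Y ⟩
      σ * f L
        -- The value of `f` depends on the length of the list too, so the equality is applied in the
        -- total space.
        ≡⟨ ≡.cong (λ (_ , L) → σ * f L) (sublist-choose B S A) ⟩
      σ * f (sublist (choose B S) A) ∎
      where
      L = sublist S (sublist B A)
      Y = (y - 1#) ^ (∣ S ∣ ℕ.∸ rk em Γ L)

    -- At second argument 0 the nullity factor is a power of -1. Its exponent is expressed through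
    -- `∣ U ∣` and the ranks of `B` and `V` in `Γ`.
    contraction-summand : ∀ U → let L = sublist U (sublist (∁ B) A) in
      mult em (Γ /⟨ sublist B A ⟩) L G₂ ×ⁿ
        ((x - 1#) ^ (rk/ (sublist (∁ B) A) ℕ.∸ rk/ L) * -1# ^ (∣ U ∣ ℕ.∸ rk/ L))
        ≈ σ * (h (sublist (extend B U) A) * -1# ^ ∣ U ∣)
    contraction-summand U = begin
      mult em (Γ /⟨ sublist B A ⟩) L G₂ ×ⁿ
        ((x - 1#) ^ (rk/ (sublist (∁ B) A) ℕ.∸ rk/ L) * -1# ^ (∣ U ∣ ℕ.∸ rk/ L))
        ≡⟨ ≡.cong₂ (λ m k → m ×ⁿ ((x - 1#) ^ k * -1# ^ (∣ U ∣ ℕ.∸ rk/ L)))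
             (mult-contraction B U G₂) (corank-contraction B U) ⟩
      mult em Γ V G₂ ×ⁿ (X * -1# ^ (∣ U ∣ ℕ.∸ rk/ L))
        ≈⟨ ×≈×1* (mult em Γ V G₂) _ ⟩
      m₂ V * (X * -1# ^ (∣ U ∣ ℕ.∸ rk/ L))
        ≈⟨ *-congˡ (*-congˡ (-1^[m∸n] (rk≤length (Γ /⟨ sublist B A ⟩) L))) ⟩
      m₂ V * (X * (-1# ^ ∣ U ∣ * -1# ^ rk/ L))
        ≈⟨ *-identityʳ _ ⟨
      m₂ V * (X * (-1# ^ ∣ U ∣ * -1# ^ rk/ L)) * 1#
        -- Of the two inserted factors `σ`, one moves to the front, and the other completes the sign
        -- of `rk/ L` to that of `rk em Γ V` by `r-extend`.
        ≈⟨ *-congˡ (-1^n*-1^n≈1 (rk em Γ (sublist B A))) ⟨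
      m₂ V * (X * (-1# ^ ∣ U ∣ * -1# ^ rk/ L)) * (σ * σ)
        ≈⟨ shuffle₃ (m₂ V) X (-1# ^ ∣ U ∣) (-1# ^ rk/ L) σ ⟩
      σ * ((m₂ V * (X * (σ * -1# ^ rk/ L))) * -1# ^ ∣ U ∣)
        ≈⟨ *-congˡ (*-congʳ (*-congˡ (*-congˡ (trans
             (reflexive (≡.cong (-1# ^_) (r-extend B U)))
             (^-homo-* -1# (rk em Γ (sublist B A)) (rk/ L)))))) ⟨
      σ * (h V * -1# ^ ∣ U ∣) ∎
      where
      L = sublist U (sublist (∁ B) A)
      V = sublist (extend B U) A
      X = (x - 1#) ^ (rk em Γ A ℕ.∸ rk em Γ V)

    -- Each polynomial contributes one factor `σ`, and the two multiply to 1.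
    T-restriction*T-contraction :
      T em Γ (sublist B A) G₁ R 0# y * T em (Γ /⟨ sublist B A ⟩) (sublist (∁ B) A) G₂ R x 0# ≈
          (∑⊆ R (∣ B ∣) λ S → f (sublist (choose B S) A)) *
          (∑⊆ R (∣ ∁ B ∣) λ U → h (sublist (extend B U) A) * -1# ^ ∣ U ∣)
    T-restriction*T-contraction = begin
      T em Γ (sublist B A) G₁ R 0# y * T em (Γ /⟨ sublist B A ⟩) (sublist (∁ B) A) G₂ R x 0#
        ≡⟨ ≡.cong₂ _*_ (T-unfold Γ (sublist B A) G₁ 0# y)
                       (T-unfold (Γ /⟨ sublist B A ⟩) (sublist (∁ B) A) G₂ x 0#) ⟩
      _
        ≈⟨ *-cong (trans (∑⊆-cong (∣ B ∣) restriction-summand) (∑⊆-*ˡ (∣ B ∣) σ _))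
                  (trans (∑⊆-cong (∣ ∁ B ∣) contraction-summand) (∑⊆-*ˡ (∣ ∁ B ∣) σ _)) ⟩
      (σ * F) * (σ * H)
        ≈⟨ *-interchange σ F σ H ⟩
      (σ * σ) * (F * H)
        ≈⟨ *-congʳ (-1^n*-1^n≈1 (rk em Γ (sublist B A))) ⟩
      1# * (F * H)
        ≈⟨ *-identityˡ _ ⟩
      F * H ∎
      where
      F = ∑⊆ R (∣ B ∣) λ S → f (sublist (choose B S) A)
      H = ∑⊆ R (∣ ∁ B ∣) λ U → h (sublist (extend B U) A) * -1# ^ ∣ U ∣

  convolution : T em Γ A (abelianGroup G₁ G₂) R x y ≈
                ∑⊆ R n (λ B → T em Γ (sublist B A) G₁ R 0# y *
                              T em (Γ /⟨ sublist B A ⟩) (sublist (∁ B) A) G₂ R x 0#)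
  convolution = begin
    T em Γ A (abelianGroup G₁ G₂) R x y
      ≡⟨ T-unfold Γ A (abelianGroup G₁ G₂) x y ⟩
    _
      ≈⟨ ∑⊆-cong n summand ⟩
    ∑⊆ R n (λ S → f (sublist S A) * h (sublist S A))
      -- Read from right to left, the inversion introduces the intermediate subset `B`.
      ≈⟨ ∑⊆-inversion n (λ S → f (sublist S A)) (λ S → h (sublist S A)) ⟨
    ∑⊆ R n (λ B → (∑⊆ R (∣ B ∣) λ S → f (sublist (choose B S) A)) *
                  (∑⊆ R (∣ ∁ B ∣) λ U → h (sublist (extend B U) A) * -1# ^ ∣ U ∣))
      ≈⟨ ∑⊆-cong n T-restriction*T-contraction ⟨
    ∑⊆ R n (λ B → T em Γ (sublist B A) G₁ R 0# y *
                  T em (Γ /⟨ sublist B A ⟩) (sublist (∁ B) A) G₂ R x 0#) ∎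

mainTheorem19 : (em : Classical) →
    ∀ {a α g₁ γ₁ g₂ γ₂ r ρ}
    (Γ : AbelianGroup a α) → FinitelyGenerated Γ →
    ∀ {n : ℕ} (A : Vec (AbelianGroup.Carrier Γ) n) →
    (G₁ : AbelianGroup g₁ γ₁) (G₂ : AbelianGroup g₂ γ₂) →
    TorsionWiseFinite G₁ → TorsionWiseFinite G₂ →
    (R : CommutativeRing r ρ) → let open CommutativeRing R in
    (x y : Carrier) →
    T em Γ A (abelianGroup G₁ G₂) R x y
    ≈ ∑⊆ R n (λ B →
    T em Γ (sublist B A) G₁ R 0# y
    * T em (Γ /⟨ sublist B A ⟩) (sublist (∁ B) A) G₂ R x 0#)
mainTheorem19 em Γ _ A G₁ G₂ _ _ R x y = Convolution.convolution em Γ A G₁ G₂ R x y
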